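{- Let $r\geq 3$ and let $k,n$ be positive integers with $k\le n$ and $n\geq 2k-1$. Label the primitive idempotents of the non-binary Johnson scheme $J_r(k,n)$ as $E_{ij}$, $(i,j)\in\mathcal{D}^\star:=\mathcal{D}$, so that $E_{ij}=\frac{1}{|S|}\sum_{(x,y)\in\mathcal{D}} q_{ij}(x,y)\,A_{xy}$ with $q_{ij}(x,y)=\frac{\binom{n}{i}}{\binom{k}{i}}K_i(x,k-y,r-1)\,H_j(y,n-i,k-i)$. Then, with this labeling, $J_r(k,n)$ is a bivariate $Q$-polynomial association scheme of type $(0,\tfrac12)$ on the region $\mathcal{D}^\star=\{(a,b)\in\mathbb{N}^2 : a+b\leq k,\ b\leq k,\ b\le n-k\}$; that is, $\mathcal{D}^\star$ is $(0,\tfrac12)$-compatible and for every $(i,j)\in\mathcal{D}^\star$ there is a $(0,\tfrac12)$-compatible bivariate polynomial $v^\star_{ij}(x,y)$ of degree $(i,j)$ such that $|S|\,E_{ij}=v^\star_{ij}(|S|E_{10},|S|E_{01})$, where products and powers of matrices are taken with respect to the Hadamard (entrywise) product (and the constant polynomial $1$ corresponds to the all-ones matrix).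
   Context: Non-binary Johnson scheme $J_r(k,n)$: let $r\ge 3$, $K=\{0,1,\dots,r-1\}$, and $S=\{\mathbf{x}\in K^n : w(\mathbf{x})=k\}$, where $w(\mathbf{x})$ is the number of nonzero components of $\mathbf{x}$. For $\mathbf{x},\mathbf{y}\in S$ let $e(\mathbf{x},\mathbf{y})=|\{i:\mathbf{x}_i=\mathbf{y}_i\neq 0\}|$ and $c(\mathbf{x},\mathbf{y})=|\{i:\mathbf{x}_i\ne0,\mathbf{y}_i\neq 0\}|$. For $(i,j)\in\mathcal{D}=\{(a,b)\in\mathbb{N}^2: a+b\le k,\ b\le k,\ b\le n-k\}$ let $R_{ij}=\{(\mathbf{x},\mathbf{y})\in S^2: e(\mathbf{x},\mathbf{y})=k-i-j,\ c(\mathbf{x},\mathbf{y})=k-j\}$ and let $A_{ij}$ be the $|S|\times|S|$ 0/1 adjacency matrix of $R_{ij}$; these form a symmetric commutative association scheme, and its primitive idempotents (orthogonal projections onto the common eigenspaces) are the matrices $E_{ij}$ above. Polynomials (binomial coefficients are generalized: $\binom{a}{b}=a(a-1)\cdots(a-b+1)/b!$ for integers $b\ge0$, and $0$ for $b<0$): Krawtchouk $K_i(x,N,p)=\sum_{\ell=0}^i(-1)^\ell(p-1)^{i-\ell}\binom{x}{\ell}\binom{N-x}{i-\ell}$; Eberlein $E_i(x,N,p)=\sum_{\ell=0}^i(-1)^\ell\binom{x}{\ell}\binom{p-x}{i-\ell}\binom{N-p-x}{i-\ell}$; Hahn $H_i(x,N,p)=\frac{\binom{N}{i}-\binom{N}{i-1}}{\binom{p}{x}\binom{N-p}{x}}E_x(i,N,p)$.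 Orders: for $0\le\alpha\le1$, $0\le\beta<1$, define $x^my^{n'}\preceq_{(\alpha,\beta)}x^iy^j$ (equivalently $(m,n')\preceq_{(\alpha,\beta)}(i,j)$ on $\mathbb{N}^2$) iff $m+\alpha n'\le i+\alpha j$ and $\beta m+n'\le\beta i+j$. A bivariate polynomial is $(\alpha,\beta)$-compatible of degree $(i,j)$ if the monomial $x^iy^j$ appears in it and every other monomial appearing is $\preceq_{(\alpha,\beta)}x^iy^j$. A subset $\mathcal{D}'\subseteq\mathbb{N}^2$ is $(\alpha,\beta)$-compatible if $(i,j)\in\mathcal{D}'$ and $(m,n')\preceq_{(\alpha,\beta)}(i,j)$ imply $(m,n')\in\mathcal{D}'$. -}

module Defs where

open import Data.Nat as ℕ using (ℕ; zero; suc; _∸_; _!)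
open import Data.Nat.Properties using (_!≢0)
open import Data.Integer as ℤ using (ℤ; +_; -[1+_])
open import Data.Rational as ℚ using (ℚ; 0ℚ; 1ℚ; ½)
open import Data.Rational.Properties using () renaming (_≟_ to _≟ℚ_)
open import Data.Fin as Fin using (Fin; toℕ)
open import Data.Product using (Σ; _×_; _,_)

open import Relation.Nullary.Decidable using (Dec; ⌊_⌋; _×-dec_)
open import Data.Bool using (Bool; true; false; if_then_else_; _∧_; not)
open import Data.List using (List; []; _∷_)
open import Relation.Binary.PropositionalEquality using (_≡_; _≢_)
open import Relation.Nullary using (yes; no; ¬_)

ℕtoℚ : ℕ → ℚ
ℕtoℚ m = + m ℚ./ 1

_^ℚ_ : ℚ → ℕ → ℚ
q ^ℚ zero  = 1ℚ
q ^ℚ suc m = q ℚ.* (q ^ℚ m)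

sgn : ℕ → ℚ
sgn ℓ = (ℚ.- 1ℚ) ^ℚ ℓ

falling : ℤ → ℕ → ℤ
falling a zero    = + 1
falling a (suc b) = falling a b ℤ.* (a ℤ.- + b)

binom : ℤ → ℤ → ℚ
binom a (+ b)    = ℚ._/_ (falling a b) (b !) {{b !≢0}}
binom a -[1+ b ] = 0ℚ

-- division with the (irrelevant) convention x/0 = 0; only used below
-- where the denominator is checked to be nonzero
_÷'_ : ℚ → ℚ → ℚ
p ÷' q with q ≟ℚ 0ℚ
... | yes _ = 0ℚ
... | no q≢0 = ℚ._÷_ p q {{ℚ.≢-nonZero q≢0}}

sumTo : ℕ → (ℕ → ℚ) → ℚ
sumTo zero    f = f 0
sumTo (suc i) f = sumTo i f ℚ.+ f (suc i)

ℤtoℚ : ℤ → ℚ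
ℤtoℚ z = z ℚ./ 1

Krawtchouk : ℕ → ℤ → ℤ → ℤ → ℚ
Krawtchouk i x N p = sumTo i λ ℓ →
  sgn ℓ ℚ.* (ℤtoℚ (p ℤ.- + 1) ^ℚ (i ∸ ℓ))
        ℚ.* binom x (+ ℓ) ℚ.* binom (N ℤ.- x) (+ i ℤ.- + ℓ)

Eberlein : ℕ → ℤ → ℤ → ℤ → ℚ
Eberlein i x N p = sumTo i λ ℓ →
  sgn ℓ ℚ.* binom x (+ ℓ) ℚ.* binom (p ℤ.- x) (+ i ℤ.- + ℓ)
        ℚ.* binom (N ℤ.- p ℤ.- x) (+ i ℤ.- + ℓ)

-- Hahn H_i(x,N,p) = (C(N,i) - C(N,i-1)) / (C(p,x) C(N-p,x)) · E_x(i,N,p).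
-- The argument x is a natural number (it is the upper summation index of E_x).
-- Where the denominator C(p,x)C(N-p,x) vanishes, the paper's quotient is 0/0;
-- there we use its polynomial continuation in x (dual Hahn form), which agrees
-- with the quotient wherever the latter is defined.
HahnContinuation : ℕ → ℕ → ℤ → ℤ → ℚ
HahnContinuation i x N p =
  (binom N (+ i) ℚ.- binom N (+ i ℤ.- + 1)) ℚ.* sumTo i λ ℓ →
    (sgn ℓ ℚ.* binom (+ i) (+ ℓ) ℚ.* binom (N ℤ.+ + 1 ℤ.- + i) (+ ℓ)
      ÷' (binom p (+ ℓ) ℚ.* binom (N ℤ.- p) (+ ℓ)))
    ℚ.* binom (+ x) (+ ℓ)

Hahn : ℕ → ℕ → ℤ → ℤ → ℚ
Hahn i x N p with binom p (+ x) ℚ.* binom (N ℤ.- p) (+ x) ≟ℚ 0ℚ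
... | yes _ = HahnContinuation i x N p
... | no  _ = ((binom N (+ i) ℚ.- binom N (+ i ℤ.- + 1))
                ÷' (binom p (+ x) ℚ.* binom (N ℤ.- p) (+ x)))
              ℚ.* Eberlein x (+ i) N p

count : ∀ {n} → (Fin n → Bool) → ℕ
count {zero}  P = 0
count {suc n} P = (if P Fin.zero then 1 else 0) ℕ.+ count (λ i → P (Fin.suc i))

nonzero : ∀ {r} → Fin r → Bool
nonzero a = not ⌊ toℕ a ℕ.≟ 0 ⌋

weight : ∀ {n r} → (Fin n → Fin r) → ℕ
weight x = count (λ i → nonzero (x i))

S : (r k n : ℕ) → Set
S r k n = Σ (Fin n → Fin r) (λ x → weight x ≡ k)

eC : ∀ {n r} → (Fin n → Fin r) → (Fin n → Fin r) → ℕ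
eC x y = count (λ i → ⌊ x i Fin.≟ y i ⌋ ∧ nonzero (x i))

cC : ∀ {n r} → (Fin n → Fin r) → (Fin n → Fin r) → ℕ
cC x y = count (λ i → nonzero (x i) ∧ nonzero (y i))

InD : (k n : ℕ) → ℕ × ℕ → Set
InD k n (a , b) = (a ℕ.+ b ℕ.≤ k) × (b ℕ.≤ k) × (b ℕ.≤ n ∸ k)

InD? : (k n : ℕ) → (ab : ℕ × ℕ) → Dec (InD k n ab)
InD? k n (a , b) = (a ℕ.+ b ℕ.≤? k) ×-dec (b ℕ.≤? k) ×-dec (b ℕ.≤? n ∸ k)

Matrix : (r k n : ℕ) → Set
Matrix r k n = S r k n → S r k n → ℚ

A : (r k n : ℕ) → ℕ → ℕ → Matrix r k n
A r k n a b (x , _) (y , _) =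
  if ⌊ eC x y ℕ.≟ k ∸ a ∸ b ⌋ ∧ ⌊ cC x y ℕ.≟ k ∸ b ⌋ then 1ℚ else 0ℚ

-- Σ_{(a,b) ∈ 𝒟} f a b   (𝒟 ⊆ {0..k}²)
sumD : (k n : ℕ) → (ℕ → ℕ → ℚ) → ℚ
sumD k n f = sumTo k λ a → sumTo k λ b →
  if ⌊ InD? k n (a , b) ⌋ then f a b else 0ℚ

q : (r k n : ℕ) → ℕ → ℕ → ℕ → ℕ → ℚ
q r k n i j x y =
  (binom (+ n) (+ i) ÷' binom (+ k) (+ i))
  ℚ.* Krawtchouk i (+ x) (+ k ℤ.- + y) (+ r ℤ.- + 1)
  ℚ.* Hahn j y (+ n ℤ.- + i) (+ k ℤ.- + i)

scaledE : (r k n : ℕ) → ℕ → ℕ → Matrix r k n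
scaledE r k n i j u v = sumD k n λ x y → q r k n i j x y ℚ.* A r k n x y u v

_∘H_ : ∀ {r k n} → Matrix r k n → Matrix r k n → Matrix r k n
(M ∘H N) u v = M u v ℚ.* N u v

J : ∀ {r k n} → Matrix r k n
J u v = 1ℚ

_^H_ : ∀ {r k n} → Matrix r k n → ℕ → Matrix r k n
M ^H zero  = J
M ^H suc m = M ∘H (M ^H m)

-- a bivariate polynomial over ℚ: a finite list of terms c·x^a·y^b
Poly : Set
Poly = List (ℚ × ℕ × ℕ)

coeff : Poly → ℕ → ℕ → ℚ
coeff []                  a b = 0ℚ
coeff ((c , a' , b') ∷ p) a b =
  (if ⌊ a' ℕ.≟ a ⌋ ∧ ⌊ b' ℕ.≟ b ⌋ then c else 0ℚ) ℚ.+ coeff p a b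

evalH : ∀ {r k n} → Poly → Matrix r k n → Matrix r k n → Matrix r k n
evalH []                 M N u v = 0ℚ
evalH ((c , a , b) ∷ p) M N u v =
  c ℚ.* ((M ^H a) ∘H (N ^H b)) u v ℚ.+ evalH p M N u v

Preceq : ℚ → ℚ → ℕ × ℕ → ℕ × ℕ → Set
Preceq α β (m , n') (i , j) =
  (ℕtoℚ m ℚ.+ α ℚ.* ℕtoℚ n' ℚ.≤ ℕtoℚ i ℚ.+ α ℚ.* ℕtoℚ j) ×
  (β ℚ.* ℕtoℚ m ℚ.+ ℕtoℚ n' ℚ.≤ β ℚ.* ℕtoℚ i ℚ.+ ℕtoℚ j)

CompatiblePoly : ℚ → ℚ → Poly → ℕ → ℕ → Set
CompatiblePoly α β v i j =
  (coeff v i j ≢ 0ℚ) ×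
  (∀ m n' → coeff v m n' ≢ 0ℚ → Preceq α β (m , n') (i , j))

CompatibleSet : ℚ → ℚ → (ℕ × ℕ → Set) → Set
CompatibleSet α β D' =
  ∀ i j m n' → D' (i , j) → Preceq α β (m , n') (i , j) → D' (m , n')

{-# OPTIONS --safe #-}
module Submission where

-- Put t = r - 2 and u = t (k - y - x) - x. As functions on 𝒟, q₁₀ is a nonzero multiple of u, and q₀₁ is
-- affine in y, nonconstant if k < n. The factor K_i(x, k - y, r - 1) is the coefficient of zⁱ in (1 + t z)^(k-y-x) (1 - z)^x, so
--   (i+1) K_{i+1} = (u - (t-1) i) K_i - t (k - y - i + 1) K_{i-1}:
-- gaining one factor y costs two steps in i, and the monomials u^a y^b of K_i satisfy a + 2b ≤ i.
-- The factor H_j(y, n - i, k - i) is a polynomial of degree j in y; this needs the equality of the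
-- Eberlein form with the Newton expansion of H_j, proved by induction on j. The monomials of q_ij
-- therefore satisfy a ≤ i and a + 2b ≤ i + 2j, which is the order ≼_(0,½).

open import Defs
open import Data.Nat as ℕ using (ℕ; zero; suc; _∸_; _≤_; _!)
import Data.Nat.Properties as ℕ
open import Data.Integer as ℤ using (ℤ; +_)
import Data.Integer.Properties as ℤ
open import Data.Rational as ℚ using (ℚ; 0ℚ; 1ℚ; ½; _+_; _*_; _-_; -_)
open import Data.Rational.Properties as ℚ using ()
open import Data.Rational.Unnormalised as ℚᵘ using (mkℚᵘ; *≡*)
import Data.Rational.Unnormalised.Properties as ℚᵘ
open import Data.Product using (Σ; Σ-syntax; _×_; _,_; proj₁; proj₂)
open import Data.Sum using (inj₁; inj₂)
open import Function using (_∘_)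
open import Level using (0ℓ)
open import Relation.Nullary using (¬_; yes; no; contradiction)
open import Relation.Nullary.Decidable using (dec⇒maybe; ⌊_⌋)
open import Relation.Binary.PropositionalEquality
open import Tactic.RingSolver using (solve-∀)
open import Tactic.RingSolver.Core.AlmostCommutativeRing using (AlmostCommutativeRing; fromCommutativeRing)
open import Data.Nat.Tactic.RingSolver using () renaming (solve-∀ to ℕ-solve-∀)
open import Data.List using ([]; _∷_; _++_; map)
open import Data.List.Relation.Unary.All as All using (All; []; _∷_)
import Data.List.Relation.Unary.All.Properties as All
open import Data.Bool using (Bool; true; false; if_then_else_; _∧_)
open import Data.Fin as Fin using (Fin)

-- Hadamard products act entrywise, and each entry of |S| E_ij is the value of q_ij at the one
-- element of 𝒟 that describes the pair of words; so an identity of matrices is an identity of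
-- functions on 𝒟. On this finite set a function has many polynomial representations: having a
-- degree means that some representation has that leading monomial.
--
-- The Eberlein sum E_y(j, N, p) involves p and N only through a = p - j and b = N - p - j. With a
-- and b fixed, raising j multiplies its generating function by 1 - z, and this is the direction of
-- the induction for the Hahn factor. For N = n - i and p = k - i, membership of (i, j) in 𝒟 makes a
-- = k - i - j and b = n - k - j natural numbers.
--
-- The case k = n is the obstacle to using q₀₁ as a coordinate: the bound 2k - 1 ≤ n leaves only k =
-- n = 1, where (0, 1) lies outside 𝒟. There y still has degree (0, 1) in the above sense, so
-- everything after that point is uniform.

ℚ-ring : AlmostCommutativeRing 0ℓ 0ℓ
ℚ-ring = fromCommutativeRing ℚ.+-*-commutativeRing (λ x → dec⇒maybe (0ℚ ℚ.≟ x))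

-- Reduces an equation that follows from hypotheses a ≡ b to a ring identity, given the multipliers.
modulo₁ : ∀ {l r a b} c → a ≡ b → l ≡ r + c * (a - b) → l ≡ r
modulo₁ {r = r} {a} c refl eq = trans eq (collapse r c a)
  where
  collapse : ∀ r c a → r + c * (a - a) ≡ r
  collapse = solve-∀ ℚ-ring

modulo₂ : ∀ {l r a b a′ b′} c c′ → a ≡ b → a′ ≡ b′ → l ≡ r + c * (a - b) + c′ * (a′ - b′) → l ≡ r
modulo₂ c c′ e e′ eq = modulo₁ c e (modulo₁ c′ e′ eq)

-- Cancellation and division in ℚ

*-cancelˡ : ∀ c {a b} → c ≢ 0ℚ → c * a ≡ c * b → a ≡ b
*-cancelˡ c {a} {b} c≢0 eq = begin
  a                        ≡⟨ undo a ⟨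
  ℚ.1/ c * (c * a)         ≡⟨ cong (ℚ.1/ c *_) eq ⟩
  ℚ.1/ c * (c * b)         ≡⟨ undo b ⟩
  b                        ∎
  where
  open ≡-Reasoning
  instance _ = ℚ.≢-nonZero c≢0
  undo : ∀ a → ℚ.1/ c * (c * a) ≡ a
  undo a = begin
    ℚ.1/ c * (c * a) ≡⟨ ℚ.*-assoc (ℚ.1/ c) c a ⟨
    ℚ.1/ c * c * a   ≡⟨ cong (_* a) (ℚ.*-inverseˡ c) ⟩
    1ℚ * a           ≡⟨ ℚ.*-identityˡ a ⟩
    a                ∎

*-≢0 : ∀ {a b} → a ≢ 0ℚ → b ≢ 0ℚ → a * b ≢ 0ℚ
*-≢0 {a} a≢0 b≢0 ab≡0 = b≢0 (*-cancelˡ a a≢0 (trans ab≡0 (sym (ℚ.*-zeroʳ a))))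

*-≢0ʳ : ∀ {a b} → a * b ≢ 0ℚ → b ≢ 0ℚ
*-≢0ʳ {a} ab≢0 refl = ab≢0 (ℚ.*-zeroʳ a)

÷′-* : ∀ p {q} → q ≢ 0ℚ → (p ÷' q) * q ≡ p
÷′-* p {q} q≢0 with q ℚ.≟ 0ℚ
... | yes q≡0 = contradiction q≡0 q≢0
... | no  ¬q≡0 = begin
  p * ℚ.1/ q * q   ≡⟨ ℚ.*-assoc p (ℚ.1/ q) q ⟩
  p * (ℚ.1/ q * q) ≡⟨ cong (p *_) (ℚ.*-inverseˡ q) ⟩
  p * 1ℚ           ≡⟨ ℚ.*-identityʳ p ⟩
  p                ∎
  where
  open ≡-Reasoning
  instance _ = ℚ.≢-nonZero ¬q≡0

*-÷′ : ∀ p {q} → q ≢ 0ℚ → q * (p ÷' q) ≡ p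
*-÷′ p {q} q≢0 = trans (ℚ.*-comm q (p ÷' q)) (÷′-* p q≢0)

÷′-≢0 : ∀ {p q} → p ≢ 0ℚ → q ≢ 0ℚ → p ÷' q ≢ 0ℚ
÷′-≢0 {p} {q} p≢0 q≢0 eq =
  p≢0 (trans (sym (÷′-* p q≢0)) (trans (cong (_* q) eq) (ℚ.*-zeroˡ q)))

-- Embeddings of ℤ and ℕ in ℚ

toℚᵘ-/ : ∀ z d → ℚ.toℚᵘ (z ℚ./ suc d) ℚᵘ.≃ mkℚᵘ z d
toℚᵘ-/ z d = ℚ.toℚᵘ-fromℚᵘ (mkℚᵘ z d)

ℤtoℚ-* : ∀ a b → ℤtoℚ (a ℤ.* b) ≡ ℤtoℚ a * ℤtoℚ b
ℤtoℚ-* a b = ℚ.toℚᵘ-injective (begin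
  ℚ.toℚᵘ (ℤtoℚ (a ℤ.* b))                 ≈⟨ toℚᵘ-/ (a ℤ.* b) 0 ⟩
  mkℚᵘ a 0 ℚᵘ.* mkℚᵘ b 0                  ≈⟨ ℚᵘ.*-cong (toℚᵘ-/ a 0) (toℚᵘ-/ b 0) ⟨
  ℚ.toℚᵘ (ℤtoℚ a) ℚᵘ.* ℚ.toℚᵘ (ℤtoℚ b)    ≈⟨ ℚ.toℚᵘ-homo-* (ℤtoℚ a) (ℤtoℚ b) ⟨
  ℚ.toℚᵘ (ℤtoℚ a * ℤtoℚ b)                ∎)
  where open ℚᵘ.≃-Reasoning

ℤtoℚ-+ : ∀ a b → ℤtoℚ (a ℤ.+ b) ≡ ℤtoℚ a + ℤtoℚ b
ℤtoℚ-+ a b = ℚ.toℚᵘ-injective (begin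
  ℚ.toℚᵘ (ℤtoℚ (a ℤ.+ b))                 ≈⟨ toℚᵘ-/ (a ℤ.+ b) 0 ⟩
  mkℚᵘ (a ℤ.+ b) 0                        ≡⟨ cong₂ (λ c d → mkℚᵘ (c ℤ.+ d) 0) (sym (ℤ.*-identityʳ a)) (sym (ℤ.*-identityʳ b)) ⟩
  mkℚᵘ a 0 ℚᵘ.+ mkℚᵘ b 0                  ≈⟨ ℚᵘ.+-cong (toℚᵘ-/ a 0) (toℚᵘ-/ b 0) ⟨
  ℚ.toℚᵘ (ℤtoℚ a) ℚᵘ.+ ℚ.toℚᵘ (ℤtoℚ b)    ≈⟨ ℚ.toℚᵘ-homo-+ (ℤtoℚ a) (ℤtoℚ b) ⟨
  ℚ.toℚᵘ (ℤtoℚ a + ℤtoℚ b)                ∎)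
  where open ℚᵘ.≃-Reasoning

ℤtoℚ-- : ∀ a b → ℤtoℚ (a ℤ.- b) ≡ ℤtoℚ a - ℤtoℚ b
ℤtoℚ-- a b = modulo₁ (- 1ℚ) (trans (cong ℤtoℚ a≡) (ℤtoℚ-+ (a ℤ.- b) b)) (ring-eq (ℤtoℚ a) (ℤtoℚ b) (ℤtoℚ (a ℤ.- b)))
  where
  a≡ : a ≡ a ℤ.- b ℤ.+ b
  a≡ = sym (trans (ℤ.+-assoc a (ℤ.- b) b) (trans (cong (λ z → a ℤ.+ z) (ℤ.+-inverseˡ b)) (ℤ.+-identityʳ a)))
  ring-eq : ∀ a b c → c ≡ a - b + (- 1ℚ) * (a - (c + b))
  ring-eq = solve-∀ ℚ-ring

ℤtoℚ-injective : ∀ {a b} → ℤtoℚ a ≡ ℤtoℚ b → a ≡ b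
ℤtoℚ-injective {a} {b} eq with ℚᵘ.≃-trans (ℚᵘ.≃-sym (toℚᵘ-/ a 0)) (ℚᵘ.≃-trans (ℚ.toℚᵘ-cong eq) (toℚᵘ-/ b 0))
... | *≡* a1≡b1 = trans (sym (ℤ.*-identityʳ a)) (trans a1≡b1 (ℤ.*-identityʳ b))

ℕtoℚ-+ : ∀ a b → ℕtoℚ (a ℕ.+ b) ≡ ℕtoℚ a + ℕtoℚ b
ℕtoℚ-+ a b = ℤtoℚ-+ (+ a) (+ b)

-- Unlike `ℕtoℚ`, which passes through a normalised fraction, `ι (suc a)` unfolds to `1ℚ + ι a`, so
-- successors become visible to ring identities.
ι : ℕ → ℚ
ι zero    = 0ℚ
ι (suc a) = 1ℚ + ι a

ι≡ℕtoℚ : ∀ a → ι a ≡ ℕtoℚ a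
ι≡ℕtoℚ zero    = refl
ι≡ℕtoℚ (suc a) = trans (cong (λ q → 1ℚ + q) (ι≡ℕtoℚ a)) (sym (ℕtoℚ-+ 1 a))

ι-injective : ∀ {a b} → ι a ≡ ι b → a ≡ b
ι-injective {a} {b} eq =
  ℤ.+-injective (ℤtoℚ-injective {+ a} {+ b} (trans (sym (ι≡ℕtoℚ a)) (trans eq (ι≡ℕtoℚ b))))

ι-suc≢0 : ∀ a → ι (suc a) ≢ 0ℚ
ι-suc≢0 a eq = ℕ.1+n≢0 (ι-injective {suc a} {0} eq)

ι-+ : ∀ a b → ι (a ℕ.+ b) ≡ ι a + ι b
ι-+ zero    b = sym (ℚ.+-identityˡ (ι b))
ι-+ (suc a) b = trans (cong (λ q → 1ℚ + q) (ι-+ a b)) (sym (ℚ.+-assoc 1ℚ (ι a) (ι b)))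

1≢0 : 1ℚ ≢ 0ℚ
1≢0 ()

/-* : ∀ z d .{{_ : ℕ.NonZero d}} → (z ℚ./ d) * ℕtoℚ d ≡ ℤtoℚ z
/-* z d@(suc d-1) = ℚ.toℚᵘ-injective (begin
  ℚ.toℚᵘ ((z ℚ./ d) * ℕtoℚ d)             ≈⟨ ℚ.toℚᵘ-homo-* (z ℚ./ d) (ℕtoℚ d) ⟩
  ℚ.toℚᵘ (z ℚ./ d) ℚᵘ.* ℚ.toℚᵘ (ℕtoℚ d)   ≈⟨ ℚᵘ.*-cong (toℚᵘ-/ z d-1) (toℚᵘ-/ (+ d) 0) ⟩
  mkℚᵘ z d-1 ℚᵘ.* mkℚᵘ (+ d) 0            ≈⟨ *≡* (trans (ℤ.*-identityʳ _) (cong (λ e → z ℤ.* + e) (sym (ℕ.*-identityʳ d)))) ⟩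
  mkℚᵘ z 0                                ≈⟨ toℚᵘ-/ z 0 ⟨
  ℚ.toℚᵘ (ℤtoℚ z)                         ∎)
  where open ℚᵘ.≃-Reasoning

-- Binomial coefficients

choose : ℕ → ℕ → ℚ
choose n       zero    = 1ℚ
choose zero    (suc k) = 0ℚ
choose (suc n) (suc k) = choose n k + choose n (suc k)

-- The subtraction in ℚ makes the identity hold for all n and k: at n = k the factor vanishes, and
-- for n < k both binomials do.
choose-step : ∀ n k → ι (suc k) * choose n (suc k) ≡ (ι n - ι k) * choose n k
choose-step zero zero = refl
choose-step zero (suc k) = trans (ℚ.*-zeroʳ (ι (suc (suc k)))) (sym (ℚ.*-zeroʳ (0ℚ - ι (suc k))))
choose-step (suc n) zero = modulo₁ 1ℚ (choose-step n 0) (ring-eq (choose n 1) (ι n))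
  where
  ring-eq : ∀ c n → 1ℚ * (1ℚ + c) ≡ (1ℚ + n - 0ℚ) * 1ℚ + 1ℚ * (1ℚ * c - (n - 0ℚ) * 1ℚ)
  ring-eq = solve-∀ ℚ-ring
choose-step (suc n) (suc k) = modulo₂ 1ℚ 1ℚ (choose-step n k) (choose-step n (suc k))
  (ring-eq (ι n) (ι k) (choose n k) (choose n (suc k)) (choose n (suc (suc k))))
  where
  ring-eq : ∀ n k b₀ b₁ b₂ → (1ℚ + (1ℚ + k)) * (b₁ + b₂) ≡
    (1ℚ + n - (1ℚ + k)) * (b₀ + b₁)
    + 1ℚ * ((1ℚ + k) * b₁ - (n - k) * b₀)
    + 1ℚ * ((1ℚ + (1ℚ + k)) * b₂ - (n - (1ℚ + k)) * b₁)
  ring-eq = solve-∀ ℚ-ring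

choose-absorb : ∀ n k → ι (suc k) * choose (suc n) (suc k) ≡ ι (suc n) * choose n k
choose-absorb n k = modulo₁ 1ℚ (choose-step n k) (ring-eq (ι n) (ι k) (choose n k) (choose n (suc k)))
  where
  ring-eq : ∀ n k b₀ b₁ → (1ℚ + k) * (b₀ + b₁) ≡ (1ℚ + n) * b₀ + 1ℚ * ((1ℚ + k) * b₁ - (n - k) * b₀)
  ring-eq = solve-∀ ℚ-ring

choose-absorb′ : ∀ n k → (ι (suc n) - ι k) * choose (suc n) k ≡ ι (suc n) * choose n k
choose-absorb′ n zero = cong (_* 1ℚ) (ℚ.+-identityʳ (ι (suc n)))
choose-absorb′ n (suc k) = modulo₁ (- 1ℚ) (choose-step n k) (ring-eq (ι n) (ι k) (choose n k) (choose n (suc k)))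
  where
  ring-eq : ∀ n k b₀ b₁ → (1ℚ + n - (1ℚ + k)) * (b₀ + b₁) ≡
    (1ℚ + n) * b₁ + (- 1ℚ) * ((1ℚ + k) * b₁ - (n - k) * b₀)
  ring-eq = solve-∀ ℚ-ring

choose≢0 : ∀ {n k} → k ℕ.≤ n → choose n k ≢ 0ℚ
choose≢0 {n} {zero} _ ()
choose≢0 {suc n} {suc k} (ℕ.s≤s k≤n) =
  *-≢0ʳ {ι (suc k)} (subst (_≢ 0ℚ) (sym (choose-absorb n k)) (*-≢0 (ι-suc≢0 n) (choose≢0 k≤n)))

!≢0 : ∀ b → ι (b !) ≢ 0ℚ
!≢0 b eq = ℕ.≢-nonZero⁻¹ (b !) {{b ℕ.!≢0}} (ι-injective eq)

binom-* : ∀ a b → binom a (+ b) * ι (b !) ≡ ℤtoℚ (falling a b)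
binom-* a b = trans (cong (binom a (+ b) *_) (ι≡ℕtoℚ (b !))) (/-* (falling a b) (b !) {{b ℕ.!≢0}})

ι-* : ∀ a b → ι (a ℕ.* b) ≡ ι a * ι b
ι-* zero    b = sym (ℚ.*-zeroˡ (ι b))
ι-* (suc a) b = trans (ι-+ b (a ℕ.* b)) (trans (cong (λ q → ι b + q) (ι-* a b)) (ring-eq (ι a) (ι b)))
  where
  ring-eq : ∀ a b → b + a * b ≡ (1ℚ + a) * b
  ring-eq = solve-∀ ℚ-ring

ℤtoℚ-pos-- : ∀ a b → ℤtoℚ (+ a ℤ.- + b) ≡ ι a - ι b
ℤtoℚ-pos-- a b = trans (ℤtoℚ-- (+ a) (+ b)) (cong₂ _-_ (sym (ι≡ℕtoℚ a)) (sym (ι≡ℕtoℚ b)))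

choose-* : ∀ a b → choose a b * ι (b !) ≡ ℤtoℚ (falling (+ a) b)
choose-* a zero = refl
choose-* a (suc b) = begin
  choose a (suc b) * ι (suc b ℕ.* b !)
    ≡⟨ cong (choose a (suc b) *_) (ι-* (suc b) (b !)) ⟩
  choose a (suc b) * (ι (suc b) * ι (b !))
    ≡⟨ modulo₂ (ι (b !)) (ι a - ι b) (choose-step a b) (choose-* a b)
        (ring-eq (choose a (suc b)) (ι (suc b)) (ι (b !)) (ι a) (ι b) (choose a b) (ℤtoℚ (falling (+ a) b))) ⟩
  ℤtoℚ (falling (+ a) b) * (ι a - ι b)
    ≡⟨ cong (ℤtoℚ (falling (+ a) b) *_) (ℤtoℚ-pos-- a b) ⟨
  ℤtoℚ (falling (+ a) b) * ℤtoℚ (+ a ℤ.- + b)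
    ≡⟨ ℤtoℚ-* (falling (+ a) b) (+ a ℤ.- + b) ⟨
  ℤtoℚ (falling (+ a) (suc b)) ∎
  where
  open ≡-Reasoning
  ring-eq : ∀ c₁ s f a b c₀ g → c₁ * (s * f) ≡
    g * (a - b) + f * (s * c₁ - (a - b) * c₀) + (a - b) * (c₀ * f - g)
  ring-eq = solve-∀ ℚ-ring

binom≡choose : ∀ a b → binom (+ a) (+ b) ≡ choose a b
binom≡choose a b = *-cancelˡ (ι (b !)) (!≢0 b) (begin
  ι (b !) * binom (+ a) (+ b) ≡⟨ ℚ.*-comm (ι (b !)) (binom (+ a) (+ b)) ⟩
  binom (+ a) (+ b) * ι (b !) ≡⟨ binom-* (+ a) b ⟩
  ℤtoℚ (falling (+ a) b)      ≡⟨ choose-* a b ⟨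
  choose a b * ι (b !)        ≡⟨ ℚ.*-comm (choose a b) (ι (b !)) ⟩
  ι (b !) * choose a b        ∎)
  where open ≡-Reasoning

-- Finite sums and convolutions

sumTo-cong : ∀ i {f g} → (∀ ℓ → ℓ ℕ.≤ i → f ℓ ≡ g ℓ) → sumTo i f ≡ sumTo i g
sumTo-cong zero    eq = eq 0 ℕ.z≤n
sumTo-cong (suc i) eq = cong₂ _+_ (sumTo-cong i (λ ℓ ℓ≤i → eq ℓ (ℕ.m≤n⇒m≤1+n ℓ≤i))) (eq (suc i) ℕ.≤-refl)

sumTo-head : ∀ i f → sumTo (suc i) f ≡ f 0 + sumTo i (f ∘ suc)
sumTo-head zero    f = refl
sumTo-head (suc i) f = trans (cong (_+ f (suc (suc i))) (sumTo-head i f))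
                             (ℚ.+-assoc (f 0) (sumTo i (f ∘ suc)) (f (suc (suc i))))

sumTo-linear : ∀ i c d f g → sumTo i (λ ℓ → c * f ℓ + d * g ℓ) ≡ c * sumTo i f + d * sumTo i g
sumTo-linear zero    c d f g = refl
sumTo-linear (suc i) c d f g = trans (cong (_+ (c * f (suc i) + d * g (suc i))) (sumTo-linear i c d f g))
  (ring-eq c d (sumTo i f) (sumTo i g) (f (suc i)) (g (suc i)))
  where
  ring-eq : ∀ c d x y v w → c * x + d * y + (c * v + d * w) ≡ c * (x + v) + d * (y + w)
  ring-eq = solve-∀ ℚ-ring

sumTo-* : ∀ i c f → sumTo i (λ ℓ → c * f ℓ) ≡ c * sumTo i f
sumTo-* zero    c f = refl
sumTo-* (suc i) c f = trans (cong (_+ c * f (suc i)) (sumTo-* i c f)) (sym (ℚ.*-distribˡ-+ c (sumTo i f) (f (suc i))))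

sumTo-zero : ∀ i {f} → (∀ ℓ → ℓ ℕ.≤ i → f ℓ ≡ 0ℚ) → sumTo i f ≡ 0ℚ
sumTo-zero zero    eq = eq 0 ℕ.z≤n
sumTo-zero (suc i) eq = cong₂ _+_ (sumTo-zero i (λ ℓ ℓ≤i → eq ℓ (ℕ.m≤n⇒m≤1+n ℓ≤i))) (eq (suc i) ℕ.≤-refl)

-- Multiplication of a generating function by z; equivalently f (i - 1), read as 0 at i = 0.
pad : (ℕ → ℚ) → ℕ → ℚ
pad f zero    = 0ℚ
pad f (suc i) = f i

conv : (ℕ → ℚ) → (ℕ → ℚ) → ℕ → ℚ
conv f g i = sumTo i λ ℓ → f ℓ * g (i ∸ ℓ)

signedChoose : ℕ → ℕ → ℚ
signedChoose x ℓ = sgn ℓ * choose x ℓ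

conv-signedChoose-zero : ∀ g i → conv (signedChoose 0) g i ≡ g i
conv-signedChoose-zero g zero    = ℚ.*-identityˡ (g 0)
conv-signedChoose-zero g (suc i) = begin
  conv (signedChoose 0) g (suc i) ≡⟨ sumTo-head i _ ⟩
  1ℚ * g (suc i) + sumTo i (λ ℓ → sgn (suc ℓ) * 0ℚ * g (i ∸ ℓ))
    ≡⟨ cong₂ _+_ (ℚ.*-identityˡ (g (suc i))) (sumTo-zero i (λ ℓ _ → vanish (sgn (suc ℓ)) (g (i ∸ ℓ)))) ⟩
  g (suc i) + 0ℚ                  ≡⟨ ℚ.+-identityʳ (g (suc i)) ⟩
  g (suc i)                       ∎
  where
  open ≡-Reasoning
  vanish : ∀ s c → s * 0ℚ * c ≡ 0ℚ
  vanish = solve-∀ ℚ-ring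

-- `signedChoose x` lists the coefficients of (1 - z)^x, and (1 - z)^(x+1) = (1 - z) (1 - z)^x. Both
-- the Krawtchouk and the Eberlein sums are such convolutions, with different g.
conv-signedChoose-suc : ∀ x g i →
  conv (signedChoose (suc x)) g i ≡ conv (signedChoose x) g i - pad (conv (signedChoose x) g) i
conv-signedChoose-suc x g zero    = sym (ℚ.+-identityʳ _)
conv-signedChoose-suc x g (suc i) = begin
  conv (signedChoose (suc x)) g (suc i)
    ≡⟨ sumTo-head i _ ⟩
  head + sumTo i (λ ℓ → sgn (suc ℓ) * (choose x ℓ + choose x (suc ℓ)) * g (i ∸ ℓ))
    ≡⟨ cong (λ c → head + c) (sumTo-cong i (λ ℓ _ → pascal (sgn ℓ) (choose x ℓ) (choose x (suc ℓ)) (g (i ∸ ℓ)))) ⟩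
  head + sumTo i (λ ℓ → 1ℚ * tail ℓ + (- 1ℚ) * (signedChoose x ℓ * g (i ∸ ℓ)))
    ≡⟨ cong (λ c → head + c) (sumTo-linear i 1ℚ (- 1ℚ) tail _) ⟩
  head + (1ℚ * sumTo i tail + (- 1ℚ) * conv (signedChoose x) g i)
    ≡⟨ regroup head (sumTo i tail) (conv (signedChoose x) g i) ⟩
  (head + sumTo i tail) - conv (signedChoose x) g i
    ≡⟨ cong (_- conv (signedChoose x) g i) (sumTo-head i _) ⟨
  conv (signedChoose x) g (suc i) - conv (signedChoose x) g i ∎
  where
  open ≡-Reasoning
  head : ℚ
  head = 1ℚ * 1ℚ * g (suc i)
  tail : ℕ → ℚ
  tail ℓ = signedChoose x (suc ℓ) * g (i ∸ ℓ)
  pascal : ∀ s b₀ b₁ c → (- 1ℚ) * s * (b₀ + b₁) * c ≡ 1ℚ * ((- 1ℚ) * s * b₁ * c) + (- 1ℚ) * (s * b₀ * c)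
  pascal = solve-∀ ℚ-ring
  regroup : ∀ h t c → h + (1ℚ * t + (- 1ℚ) * c) ≡ (h + t) - c
  regroup = solve-∀ ℚ-ring

-- Krawtchouk polynomials

weightedChoose : ℚ → ℕ → ℕ → ℚ
weightedChoose t m ℓ = (t ^ℚ ℓ) * choose m ℓ

krawtchouk : ℚ → ℕ → ℕ → ℕ → ℚ
krawtchouk t m x = conv (signedChoose x) (weightedChoose t m)

-- Coefficient form of (1 + t z)(1 - z) F' = (u - t w z) F. Multiplying F by 1 - z preserves the
-- shape and turns (u, w) into (u - 1, w + 1), which is why u and w are separate parameters.
KrawtchoukRec : (t u w : ℚ) → (ℕ → ℚ) → Set
KrawtchoukRec t u w f = ∀ i →
  ι (suc i) * f (suc i) ≡ (u - (t - 1ℚ) * ι i) * f i - t * (w + 1ℚ - ι i) * pad f i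

KrawtchoukRec-cong : ∀ {t u w f g} → (∀ i → f i ≡ g i) → KrawtchoukRec t u w f → KrawtchoukRec t u w g
KrawtchoukRec-cong {t} {u} {w} {f} {g} eq rec i = begin
  ι (suc i) * g (suc i) ≡⟨ cong (ι (suc i) *_) (eq (suc i)) ⟨
  ι (suc i) * f (suc i) ≡⟨ rec i ⟩
  (u - (t - 1ℚ) * ι i) * f i - t * (w + 1ℚ - ι i) * pad f i
    ≡⟨ cong₂ (λ a b → (u - (t - 1ℚ) * ι i) * a - t * (w + 1ℚ - ι i) * b) (eq i) (pad-cong i) ⟩
  (u - (t - 1ℚ) * ι i) * g i - t * (w + 1ℚ - ι i) * pad g i ∎
  where
  open ≡-Reasoning
  pad-cong : ∀ i → pad f i ≡ pad g i
  pad-cong zero    = refl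
  pad-cong (suc i) = eq i

-- F = (1 + t z)^m satisfies (1 + t z) F' = t m F; multiplied by 1 - z this is the equation with u =
-- t m and w = m. Hence two consecutive instances of `choose-step` are combined.
weightedChoose-rec : ∀ t m → KrawtchoukRec t (t * ι m) (ι m) (weightedChoose t m)
weightedChoose-rec t m zero = modulo₁ t (choose-step m 0) (ring-eq t (ι m) (choose m 1))
  where
  ring-eq : ∀ t m c → 1ℚ * (t * 1ℚ * c) ≡
    (t * m - (t - 1ℚ) * 0ℚ) * (1ℚ * 1ℚ) - t * (m + 1ℚ - 0ℚ) * 0ℚ + t * (1ℚ * c - (m - 0ℚ) * 1ℚ)
  ring-eq = solve-∀ ℚ-ring
weightedChoose-rec t m (suc i) =
  modulo₂ (t * (t * (t ^ℚ i))) (- (t * (t ^ℚ i))) (choose-step m (suc i)) (choose-step m i)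
    (ring-eq t (ι m) (ι i) (t ^ℚ i) (choose m i) (choose m (suc i)) (choose m (suc (suc i))))
  where
  ring-eq : ∀ t m i s b₀ b₁ b₂ → (1ℚ + (1ℚ + i)) * (t * (t * s) * b₂) ≡
    (t * m - (t - 1ℚ) * (1ℚ + i)) * (t * s * b₁) - t * (m + 1ℚ - (1ℚ + i)) * (s * b₀)
    + t * (t * s) * ((1ℚ + (1ℚ + i)) * b₂ - (m - (1ℚ + i)) * b₁)
    + (- (t * s)) * ((1ℚ + i) * b₁ - (m - i) * b₀)
  ring-eq = solve-∀ ℚ-ring

-- Multiplying the generating function by 1 - z.
KrawtchoukRec-shift : ∀ {t u w} f → KrawtchoukRec t u w f →
  KrawtchoukRec t (u - 1ℚ) (1ℚ + w) (λ i → f i - pad f i)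
KrawtchoukRec-shift {t} {u} {w} f rec zero = modulo₁ 1ℚ (rec 0) (ring-eq t u w (f 0) (f 1))
  where
  ring-eq : ∀ t u w f₀ f₁ → (1ℚ + 0ℚ) * (f₁ - f₀) ≡
    (u - 1ℚ - (t - 1ℚ) * 0ℚ) * (f₀ - 0ℚ) - t * (1ℚ + w + 1ℚ - 0ℚ) * 0ℚ
    + 1ℚ * ((1ℚ + 0ℚ) * f₁ - ((u - (t - 1ℚ) * 0ℚ) * f₀ - t * (w + 1ℚ - 0ℚ) * 0ℚ))
  ring-eq = solve-∀ ℚ-ring
KrawtchoukRec-shift {t} {u} {w} f rec (suc i) =
  modulo₂ 1ℚ (- 1ℚ) (rec (suc i)) (rec i) (ring-eq t u w (ι i) (pad f i) (f i) (f (suc i)) (f (suc (suc i))))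
  where
  ring-eq : ∀ t u w i f₋ f₀ f₁ f₂ → (1ℚ + (1ℚ + i)) * (f₂ - f₁) ≡
    (u - 1ℚ - (t - 1ℚ) * (1ℚ + i)) * (f₁ - f₀) - t * (1ℚ + w + 1ℚ - (1ℚ + i)) * (f₀ - f₋)
    + 1ℚ * ((1ℚ + (1ℚ + i)) * f₂ - ((u - (t - 1ℚ) * (1ℚ + i)) * f₁ - t * (w + 1ℚ - (1ℚ + i)) * f₀))
    + (- 1ℚ) * ((1ℚ + i) * f₁ - ((u - (t - 1ℚ) * i) * f₀ - t * (w + 1ℚ - i) * f₋))
  ring-eq = solve-∀ ℚ-ring

krawtchouk-rec : ∀ t m x → KrawtchoukRec t (t * ι m - ι x) (ι x + ι m) (krawtchouk t m x)
krawtchouk-rec t m zero =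
  subst₂ (λ u w → KrawtchoukRec t u w (krawtchouk t m 0))
    (sym (ℚ.+-identityʳ (t * ι m))) (sym (ℚ.+-identityˡ (ι m)))
    (KrawtchoukRec-cong {t} {t * ι m} {ι m} (λ i → sym (conv-signedChoose-zero (weightedChoose t m) i)) (weightedChoose-rec t m))
krawtchouk-rec t m (suc x) =
  subst₂ (λ u w → KrawtchoukRec t u w (krawtchouk t m (suc x)))
    (ring-eq (t * ι m) (ι x)) (sym (ℚ.+-assoc 1ℚ (ι x) (ι m)))
    (KrawtchoukRec-cong {t} {t * ι m - ι x - 1ℚ} {1ℚ + (ι x + ι m)}
      (λ i → sym (conv-signedChoose-suc x (weightedChoose t m) i))
      (KrawtchoukRec-shift {t} {t * ι m - ι x} {ι x + ι m} (krawtchouk t m x) (krawtchouk-rec t m x)))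
  where
  ring-eq : ∀ s x → s - x - 1ℚ ≡ s - (1ℚ + x)
  ring-eq = solve-∀ ℚ-ring

ℤ-monus : ∀ {a b} → b ℕ.≤ a → + a ℤ.- + b ≡ + (a ∸ b)
ℤ-monus {a} {b} b≤a = trans (ℤ.m-n≡m⊖n a b) (ℤ.⊖-≥ b≤a)

Krawtchouk≡krawtchouk : ∀ i x m {N} p → N ℤ.- + x ≡ + m →
  Krawtchouk i (+ x) N p ≡ krawtchouk (ℤtoℚ (p ℤ.- + 1)) m x i
Krawtchouk≡krawtchouk i x m {N} p eq = sumTo-cong i term
  where
  t : ℚ
  t = ℤtoℚ (p ℤ.- + 1)
  ring-eq : ∀ a b c d → a * b * c * d ≡ a * c * (b * d)
  ring-eq = solve-∀ ℚ-ring
  term : ∀ ℓ → ℓ ℕ.≤ i →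
    sgn ℓ * (t ^ℚ (i ∸ ℓ)) * binom (+ x) (+ ℓ) * binom (N ℤ.- + x) (+ i ℤ.- + ℓ)
    ≡ signedChoose x ℓ * weightedChoose t m (i ∸ ℓ)
  term ℓ ℓ≤i = trans
    (cong₂ (λ b c → sgn ℓ * (t ^ℚ (i ∸ ℓ)) * b * c) (binom≡choose x ℓ)
      (trans (cong₂ binom eq (ℤ-monus ℓ≤i)) (binom≡choose m (i ∸ ℓ))))
    (ring-eq (sgn ℓ) (t ^ℚ (i ∸ ℓ)) (choose x ℓ) (choose m (i ∸ ℓ)))

-- Hahn polynomials

module _ (a b : ℕ) where

  private
    -- The numbers p + 1 and m + 1 at level j, which are p and m at level j + 1. Below, local names
    -- `p` and `m` stand for these.
    P M : ℕ → ℚ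
    P j = ι (suc (j ℕ.+ a))
    M j = ι (suc (j ℕ.+ b))

    PM≢0 : ∀ j → P j * M j ≢ 0ℚ
    PM≢0 j = *-≢0 (ι-suc≢0 (j ℕ.+ a)) (ι-suc≢0 (j ℕ.+ b))

  -- For p = j + a and N - p = m = j + b, hahnCoeff j ℓ is the coefficient of C(y,ℓ) in the sum of HahnContinuation.
  -- The recursion is (p+1)(m+1) ψ_{j+1}(y) = (p+1-y)(m+1-y) ψ_j(y) - y² ψ_j(y-1), the Pascal rule for
  -- E_y(j) / (C(p,y) C(m,y)), written in the basis C(y,ℓ).
  mutual
    hahnCoeff : ℕ → ℕ → ℚ
    hahnCoeff zero    zero    = 1ℚ
    hahnCoeff zero    (suc ℓ) = 0ℚ
    hahnCoeff (suc j) ℓ       = hahnNumer j ℓ ÷' (P j * M j)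

    hahnNumer : ℕ → ℕ → ℚ
    hahnNumer j ℓ = (P j - ι ℓ) * (M j - ι ℓ) * hahnCoeff j ℓ
                  - ι ℓ * (P j + M j + 1ℚ - ι ℓ) * pad (hahnCoeff j) ℓ

  hahnCoeff-suc : ∀ j ℓ → P j * M j * hahnCoeff (suc j) ℓ ≡ hahnNumer j ℓ
  hahnCoeff-suc j ℓ = *-÷′ (hahnNumer j ℓ) (PM≢0 j)

  hahnCoeff-zero : ∀ j → hahnCoeff j 0 ≡ 1ℚ
  hahnCoeff-zero zero    = refl
  hahnCoeff-zero (suc j) = *-cancelˡ (P j * M j) (PM≢0 j) (trans (hahnCoeff-suc j 0)
    (trans (cong (λ h → (P j - 0ℚ) * (M j - 0ℚ) * h - 0ℚ * (P j + M j + 1ℚ - 0ℚ) * 0ℚ) (hahnCoeff-zero j))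
      (ring-eq (P j) (M j))))
    where
    ring-eq : ∀ p m → (p - 0ℚ) * (m - 0ℚ) * 1ℚ - 0ℚ * (p + m + 1ℚ - 0ℚ) * 0ℚ ≡ p * m * 1ℚ
    ring-eq = solve-∀ ℚ-ring

  hahnCoeff-vanish : ∀ {j ℓ} → j ℕ.< ℓ → hahnCoeff j ℓ ≡ 0ℚ
  hahnCoeff-vanish {zero}  (ℕ.s≤s _)   = refl
  hahnCoeff-vanish {suc j} {suc ℓ} (ℕ.s≤s j<ℓ) = *-cancelˡ (P j * M j) (PM≢0 j) (trans (hahnCoeff-suc j (suc ℓ))
    (trans (cong₂ (λ h h′ → (P j - ι (suc ℓ)) * (M j - ι (suc ℓ)) * h - ι (suc ℓ) * (P j + M j + 1ℚ - ι (suc ℓ)) * h′)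
             (hahnCoeff-vanish (ℕ.m≤n⇒m≤1+n j<ℓ)) (hahnCoeff-vanish j<ℓ))
      (ring-eq (P j) (M j) (ι (suc ℓ)))))
    where
    ring-eq : ∀ p m l → (p - l) * (m - l) * 0ℚ - l * (p + m + 1ℚ - l) * 0ℚ ≡ p * m * 0ℚ
    ring-eq = solve-∀ ℚ-ring

  -- The closed form of the recursive coefficients, where j + a + b + 1 is N + 1 - j. It identifies
  -- them with those of `HahnContinuation` and shows that the leading one is nonzero.
  hahnCoeff-formula : ∀ j ℓ →
    choose (j ℕ.+ a) ℓ * choose (j ℕ.+ b) ℓ * hahnCoeff j ℓ
      ≡ sgn ℓ * choose j ℓ * choose (suc (j ℕ.+ (a ℕ.+ b))) ℓ
  hahnCoeff-formula zero    zero    = refl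
  hahnCoeff-formula zero    (suc ℓ) = ring-eq (choose a (suc ℓ)) (choose b (suc ℓ)) (sgn (suc ℓ)) (choose (suc (a ℕ.+ b)) (suc ℓ))
    where
    ring-eq : ∀ x y s c → x * y * 0ℚ ≡ s * 0ℚ * c
    ring-eq = solve-∀ ℚ-ring
  hahnCoeff-formula (suc j) zero    = cong (1ℚ * 1ℚ *_) (hahnCoeff-zero (suc j))
  -- The second term of `hahnNumer` carries one factor L = ℓ + 1; the extra L supplies the other, so
  -- that both upper binomials can be absorbed.
  hahnCoeff-formula (suc j) (suc ℓ) = *-cancelˡ L (ι-suc≢0 ℓ) (*-cancelˡ (P j * M j) (PM≢0 j) (begin
    p * m * (L * (b⁺ * c⁺ * h⁺))
      ≡⟨ modulo₁ (L * b⁺ * c⁺) (hahnCoeff-suc j (suc ℓ)) (expand p m L b⁺ c⁺ h⁺ h₁ h₀) ⟩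
    L * ((p - L) * b⁺) * ((m - L) * c⁺) * h₁ - (L * b⁺) * (L * c⁺) * (p + m + 1ℚ - L) * h₀
      ≡⟨ cong₂ (λ x y → L * x * y * h₁ - (L * b⁺) * (L * c⁺) * (p + m + 1ℚ - L) * h₀)
           (choose-absorb′ (j ℕ.+ a) (suc ℓ)) (choose-absorb′ (j ℕ.+ b) (suc ℓ)) ⟩
    L * (p * b₁) * (m * c₁) * h₁ - (L * b⁺) * (L * c⁺) * (p + m + 1ℚ - L) * h₀
      ≡⟨ cong₂ (λ x y → L * (p * b₁) * (m * c₁) * h₁ - x * y * (p + m + 1ℚ - L) * h₀)
           (choose-absorb (j ℕ.+ a) ℓ) (choose-absorb (j ℕ.+ b) ℓ) ⟩
    L * (p * b₁) * (m * c₁) * h₁ - (p * b₀) * (m * c₀) * (p + m + 1ℚ - L) * h₀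
      ≡⟨ modulo₂ (p * m * L) (- (p * m * (p + m + 1ℚ - L))) (hahnCoeff-formula j (suc ℓ)) (hahnCoeff-formula j ℓ)
           (use-ih p m L b₀ b₁ c₀ c₁ h₀ h₁ s x₀ x₁ y₀ y₁) ⟩
    p * m * ((- 1ℚ) * s * (L * x₁ * y₁ + (p + m + 1ℚ - L) * (x₀ * y₀)))
      ≡⟨ cong (λ w → p * m * ((- 1ℚ) * s * (L * x₁ * y₁ + (w + 1ℚ - L) * (x₀ * y₀)))) p+m≡ ⟩
    p * m * ((- 1ℚ) * s * (L * x₁ * y₁ + (1ℚ + ι j + ι N + 1ℚ - L) * (x₀ * y₀)))
      -- Here P + M + 1 - L = (j - ℓ) + (N - ℓ) + L. Since (j - ℓ) x₀ = L x₁ and (N - ℓ) y₀ = L y₁,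
      -- the bracket factors as L (x₀ + x₁)(y₀ + y₁): Pascal's rule in j and N at once.
      ≡⟨ modulo₂ (p * m * s * y₀) (p * m * s * x₀) (choose-step j ℓ) (choose-step N ℓ)
           (pascal p m (ι ℓ) s x₀ x₁ y₀ y₁ (ι j) (ι N)) ⟩
    p * m * (L * ((- 1ℚ) * s * (x₀ + x₁) * (y₀ + y₁))) ∎))
    where
    open ≡-Reasoning
    N : ℕ
    N = suc (j ℕ.+ (a ℕ.+ b))
    p m L s b⁺ c⁺ h⁺ b₀ b₁ c₀ c₁ h₀ h₁ x₀ x₁ y₀ y₁ : ℚ
    p = P j ; m = M j ; L = ι (suc ℓ) ; s = sgn ℓ
    b⁺ = choose (suc (j ℕ.+ a)) (suc ℓ)
    c⁺ = choose (suc (j ℕ.+ b)) (suc ℓ)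
    h⁺ = hahnCoeff (suc j) (suc ℓ)
    b₀ = choose (j ℕ.+ a) ℓ ; b₁ = choose (j ℕ.+ a) (suc ℓ)
    c₀ = choose (j ℕ.+ b) ℓ ; c₁ = choose (j ℕ.+ b) (suc ℓ)
    h₀ = hahnCoeff j ℓ ; h₁ = hahnCoeff j (suc ℓ)
    x₀ = choose j ℓ ; x₁ = choose j (suc ℓ)
    y₀ = choose N ℓ ; y₁ = choose N (suc ℓ)
    expand : ∀ p m L b c h h₁ h₀ → p * m * (L * (b * c * h)) ≡
      L * ((p - L) * b) * ((m - L) * c) * h₁ - (L * b) * (L * c) * (p + m + 1ℚ - L) * h₀
      + (L * b * c) * (p * m * h - ((p - L) * (m - L) * h₁ - L * (p + m + 1ℚ - L) * h₀))
    expand = solve-∀ ℚ-ring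
    use-ih : ∀ p m L b₀ b₁ c₀ c₁ h₀ h₁ s x₀ x₁ y₀ y₁ →
      L * (p * b₁) * (m * c₁) * h₁ - (p * b₀) * (m * c₀) * (p + m + 1ℚ - L) * h₀ ≡
      p * m * ((- 1ℚ) * s * (L * x₁ * y₁ + (p + m + 1ℚ - L) * (x₀ * y₀)))
      + (p * m * L) * (b₁ * c₁ * h₁ - (- 1ℚ) * s * x₁ * y₁)
      + (- (p * m * (p + m + 1ℚ - L))) * (b₀ * c₀ * h₀ - s * x₀ * y₀)
    use-ih = solve-∀ ℚ-ring
    pascal : ∀ p m l s x₀ x₁ y₀ y₁ j S →
      p * m * ((- 1ℚ) * s * ((1ℚ + l) * x₁ * y₁ + (1ℚ + j + S + 1ℚ - (1ℚ + l)) * (x₀ * y₀))) ≡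
      p * m * ((1ℚ + l) * ((- 1ℚ) * s * (x₀ + x₁) * (y₀ + y₁)))
      + (p * m * s * y₀) * ((1ℚ + l) * x₁ - (j - l) * x₀)
      + (p * m * s * x₀) * ((1ℚ + l) * y₁ - (S - l) * y₀)
    pascal = solve-∀ ℚ-ring
    p+m≡ : p + m ≡ 1ℚ + ι j + ι N
    p+m≡ = begin
      p + m ≡⟨ cong₂ (λ x y → 1ℚ + x + (1ℚ + y)) (ι-+ j a) (ι-+ j b) ⟩
      1ℚ + (ι j + ι a) + (1ℚ + (ι j + ι b)) ≡⟨ regroup (ι j) (ι a) (ι b) ⟩
      1ℚ + ι j + (1ℚ + (ι j + (ι a + ι b)))
        ≡⟨ cong (λ x → 1ℚ + ι j + (1ℚ + x)) (trans (ι-+ j (a ℕ.+ b)) (cong (λ x → ι j + x) (ι-+ a b))) ⟨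
      1ℚ + ι j + ι N ∎
      where
      regroup : ∀ j a b → 1ℚ + (j + a) + (1ℚ + (j + b)) ≡ 1ℚ + j + (1ℚ + (j + (a + b)))
      regroup = solve-∀ ℚ-ring

  hahnSum : ℕ → ℕ → ℚ
  hahnSum j y = sumTo j λ ℓ → hahnCoeff j ℓ * choose y ℓ

  hahnSum-zero : ∀ j → hahnSum j 0 ≡ 1ℚ
  hahnSum-zero zero    = refl
  hahnSum-zero (suc j) = trans (sumTo-head j _) (cong₂ _+_
    (trans (ℚ.*-identityʳ _) (hahnCoeff-zero (suc j)))
    (sumTo-zero j (λ ℓ _ → ℚ.*-zeroʳ (hahnCoeff (suc j) (suc ℓ)))))

  -- With x = y + 1, x² C(y,ℓ) = x (x - ℓ) C(x,ℓ), and (P - x)(M - x) - x (x - ℓ) = (P - ℓ)(M - ℓ) -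
  -- (x - ℓ)(P + M - ℓ). As (x - ℓ) C(x,ℓ) = (ℓ + 1) C(x,ℓ+1), the last product moves to the next
  -- basis element; this is the origin of the two terms of `hahnNumer`.
  hahnSum-suc : ∀ j y → P j * M j * hahnSum (suc j) (suc y) ≡
    (P j - ι (suc y)) * (M j - ι (suc y)) * hahnSum j (suc y) + (- (ι (suc y) * ι (suc y))) * hahnSum j y
  hahnSum-suc j y = begin
    p * m * hahnSum (suc j) x
      ≡⟨ sumTo-* (suc j) (p * m) _ ⟨
    sumTo (suc j) (λ ℓ → p * m * (hahnCoeff (suc j) ℓ * choose x ℓ))
      ≡⟨ sumTo-cong (suc j) (λ ℓ _ → modulo₁ (choose x ℓ) (hahnCoeff-suc j ℓ)
           (split p m (ι ℓ) (hahnCoeff (suc j) ℓ) (hahnCoeff j ℓ) (pad (hahnCoeff j) ℓ) (choose x ℓ))) ⟩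
    sumTo (suc j) (λ ℓ → 1ℚ * F ℓ + (- 1ℚ) * G ℓ)
      ≡⟨ sumTo-linear (suc j) 1ℚ (- 1ℚ) F G ⟩
    1ℚ * (sumTo j F + F (suc j)) + (- 1ℚ) * sumTo (suc j) G
      -- Both boundary terms vanish: F at j + 1 because `hahnCoeff j` stops at j, and G at 0 because
      -- of its factor `ι 0`. Then F and the shifted G run over the same range.
      ≡⟨ cong₂ (λ z w → 1ℚ * (sumTo j F + z) + (- 1ℚ) * w) F-end (sumTo-head j G) ⟩
    1ℚ * (sumTo j F + 0ℚ) + (- 1ℚ) * (G 0 + sumTo j (G ∘ suc))
      ≡⟨ ends (sumTo j F) p m (choose x 0) (sumTo j (G ∘ suc)) ⟩
    1ℚ * sumTo j F + (- 1ℚ) * sumTo j (G ∘ suc)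
      ≡⟨ sumTo-linear j 1ℚ (- 1ℚ) F (G ∘ suc) ⟨
    sumTo j (λ ℓ → 1ℚ * F ℓ + (- 1ℚ) * G (suc ℓ))
      ≡⟨ sumTo-cong j (λ ℓ _ → modulo₂ (- ((p + m - ι ℓ) * hahnCoeff j ℓ)) (- (ι x * hahnCoeff j ℓ))
           (choose-step x ℓ) (choose-absorb′ y ℓ)
           (term p m (ι ℓ) (ι x) (hahnCoeff j ℓ) (choose x ℓ) (choose x (suc ℓ)) (choose y ℓ))) ⟩
    sumTo j (λ ℓ → (p - ι x) * (m - ι x) * (hahnCoeff j ℓ * choose x ℓ)
                 + (- (ι x * ι x)) * (hahnCoeff j ℓ * choose y ℓ))
      ≡⟨ sumTo-linear j ((p - ι x) * (m - ι x)) (- (ι x * ι x))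
           (λ ℓ → hahnCoeff j ℓ * choose x ℓ) (λ ℓ → hahnCoeff j ℓ * choose y ℓ) ⟩
    (p - ι x) * (m - ι x) * hahnSum j x + (- (ι x * ι x)) * hahnSum j y ∎
    where
    open ≡-Reasoning
    x : ℕ
    x = suc y
    p m : ℚ
    p = P j ; m = M j
    F G : ℕ → ℚ
    F ℓ = (p - ι ℓ) * (m - ι ℓ) * hahnCoeff j ℓ * choose x ℓ
    G ℓ = ι ℓ * (p + m + 1ℚ - ι ℓ) * pad (hahnCoeff j) ℓ * choose x ℓ
    split : ∀ p m l h h₁ h₀ c → p * m * (h * c) ≡
      1ℚ * ((p - l) * (m - l) * h₁ * c) + (- 1ℚ) * (l * (p + m + 1ℚ - l) * h₀ * c)
      + c * (p * m * h - ((p - l) * (m - l) * h₁ - l * (p + m + 1ℚ - l) * h₀))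
    split = solve-∀ ℚ-ring
    F-end : F (suc j) ≡ 0ℚ
    F-end = trans (cong (λ h → (p - ι (suc j)) * (m - ι (suc j)) * h * choose x (suc j))
                    (hahnCoeff-vanish (ℕ.n<1+n j)))
                  (vanish ((p - ι (suc j)) * (m - ι (suc j))) (choose x (suc j)))
      where
      vanish : ∀ q c → q * 0ℚ * c ≡ 0ℚ
      vanish = solve-∀ ℚ-ring
    ends : ∀ f p m c g → 1ℚ * (f + 0ℚ) + (- 1ℚ) * (0ℚ * (p + m + 1ℚ - 0ℚ) * 0ℚ * c + g) ≡ 1ℚ * f + (- 1ℚ) * g
    ends = solve-∀ ℚ-ring
    term : ∀ p m l x h c c₁ d →
      1ℚ * ((p - l) * (m - l) * h * c) + (- 1ℚ) * ((1ℚ + l) * (p + m + 1ℚ - (1ℚ + l)) * h * c₁) ≡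
      (p - x) * (m - x) * (h * c) + (- (x * x)) * (h * d)
      + (- ((p + m - l) * h)) * ((1ℚ + l) * c₁ - (x - l) * c)
      + (- (x * h)) * ((x - l) * c - x * d)
    term = solve-∀ ℚ-ring

  -- The left side is the Eberlein sum with p - j = a and N - p - j = b. Raising j takes a
  -- difference in y; absorbing the binomials on the right turns that difference into `hahnSum-suc`.
  -- The multiplied form remains meaningful where C(p,y) C(m,y) is zero.
  conv-signedChoose-hahnSum : ∀ j y →
    conv (signedChoose j) (λ s → choose a s * choose b s) y
      ≡ choose (j ℕ.+ a) y * choose (j ℕ.+ b) y * hahnSum j y
  conv-signedChoose-hahnSum zero y = trans (conv-signedChoose-zero (λ s → choose a s * choose b s) y)
    (sym (ℚ.*-identityʳ (choose a y * choose b y)))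
  conv-signedChoose-hahnSum (suc j) zero = sym (cong (1ℚ * 1ℚ *_) (hahnSum-zero (suc j)))
  conv-signedChoose-hahnSum (suc j) (suc y) = *-cancelˡ (P j * M j) (PM≢0 j) (begin
    p * m * conv (signedChoose (suc j)) g (suc y)
      ≡⟨ cong (p * m *_) (conv-signedChoose-suc j g (suc y)) ⟩
    p * m * (conv (signedChoose j) g (suc y) - conv (signedChoose j) g y)
      ≡⟨ cong₂ (λ v w → p * m * (v - w)) (conv-signedChoose-hahnSum j (suc y)) (conv-signedChoose-hahnSum j y) ⟩
    p * m * (b₁ * c₁ * hahnSum j x - b₀ * c₀ * hahnSum j y)
      ≡⟨ regroup p m b₁ c₁ b₀ c₀ (hahnSum j x) (hahnSum j y) ⟩
    (p * b₁) * (m * c₁) * hahnSum j x - (p * b₀) * (m * c₀) * hahnSum j y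
      ≡⟨ cong₂ (λ v w → v * w * hahnSum j x - (p * b₀) * (m * c₀) * hahnSum j y)
           (choose-absorb′ (j ℕ.+ a) x) (choose-absorb′ (j ℕ.+ b) x) ⟨
    ((p - ι x) * b⁺) * ((m - ι x) * c⁺) * hahnSum j x - (p * b₀) * (m * c₀) * hahnSum j y
      ≡⟨ cong₂ (λ v w → ((p - ι x) * b⁺) * ((m - ι x) * c⁺) * hahnSum j x - v * w * hahnSum j y)
           (choose-absorb (j ℕ.+ a) y) (choose-absorb (j ℕ.+ b) y) ⟨
    ((p - ι x) * b⁺) * ((m - ι x) * c⁺) * hahnSum j x - (ι x * b⁺) * (ι x * c⁺) * hahnSum j y
      ≡⟨ modulo₁ (- (b⁺ * c⁺)) (hahnSum-suc j y)
           (collect p m (ι x) b⁺ c⁺ (hahnSum j x) (hahnSum j y) (hahnSum (suc j) x)) ⟩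
    p * m * (b⁺ * c⁺ * hahnSum (suc j) x) ∎)
    where
    open ≡-Reasoning
    x : ℕ
    x = suc y
    p m b⁺ c⁺ b₀ b₁ c₀ c₁ : ℚ
    p = P j ; m = M j
    b⁺ = choose (suc (j ℕ.+ a)) x ; c⁺ = choose (suc (j ℕ.+ b)) x
    b₀ = choose (j ℕ.+ a) y ; b₁ = choose (j ℕ.+ a) x
    c₀ = choose (j ℕ.+ b) y ; c₁ = choose (j ℕ.+ b) x
    g : ℕ → ℚ
    g s = choose a s * choose b s
    regroup : ∀ p m b₁ c₁ b₀ c₀ h₁ h₀ → p * m * (b₁ * c₁ * h₁ - b₀ * c₀ * h₀) ≡
      (p * b₁) * (m * c₁) * h₁ - (p * b₀) * (m * c₀) * h₀
    regroup = solve-∀ ℚ-ring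
    collect : ∀ p m x b c h₁ h₀ h → ((p - x) * b) * ((m - x) * c) * h₁ - (x * b) * (x * c) * h₀ ≡
      p * m * (b * c * h) + (- (b * c)) * (p * m * h - ((p - x) * (m - x) * h₁ + (- (x * x)) * h₀))
    collect = solve-∀ ℚ-ring

  -- At ℓ = j the right side of `hahnCoeff-formula` is a sign times C(j + a + b + 1, j).
  hahnCoeff-lead≢0 : ∀ j → hahnCoeff j j ≢ 0ℚ
  hahnCoeff-lead≢0 j = *-≢0ʳ {choose (j ℕ.+ a) j * choose (j ℕ.+ b) j}
    (subst (_≢ 0ℚ) (sym (hahnCoeff-formula j j))
      (*-≢0 (*-≢0 (sgn≢0 j) (choose≢0 {j} {j} ℕ.≤-refl)) (choose≢0 {suc (j ℕ.+ (a ℕ.+ b))} {j} (ℕ.m≤n⇒m≤1+n (ℕ.m≤m+n j (a ℕ.+ b))))))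
    where
    sgn≢0 : ∀ ℓ → sgn ℓ ≢ 0ℚ
    sgn≢0 zero    ()
    sgn≢0 (suc ℓ) = *-≢0 { - 1ℚ} (λ ()) (sgn≢0 ℓ)

hahnFactor : ℕ → ℕ → ℚ
hahnFactor N j = choose N j - pad (choose N) j

-- By `choose-step`, (j + 1)(C(N,j+1) - C(N,j)) = (N - 2j - 1) C(N,j), and 2(j + 1) ≤ N makes the
-- factor N - 2j - 1 = c + 1 positive.
hahnFactor≢0 : ∀ N j → j ℕ.+ j ℕ.≤ N → hahnFactor N j ≢ 0ℚ
hahnFactor≢0 N zero    _  = λ ()
hahnFactor≢0 N (suc j) le = *-≢0ʳ {ι (suc j)} (subst (_≢ 0ℚ) (sym eq)
  (*-≢0 (ι-suc≢0 c) (choose≢0 (ℕ.≤-trans (ℕ.m≤m+n j j) (ℕ.≤-trans (ℕ.n≤1+n _) (ℕ.≤-trans (ℕ.n≤1+n _) le′))))))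
  where
  le′ : suc (suc (j ℕ.+ j)) ℕ.≤ N
  le′ = subst (ℕ._≤ N) (cong suc (ℕ.+-suc j j)) le
  c : ℕ
  c = N ∸ suc (suc (j ℕ.+ j))
  N≡ : ι N ≡ ι c + (1ℚ + (1ℚ + (ι j + ι j)))
  N≡ = trans (cong ι (sym (ℕ.m∸n+n≡m le′))) (trans (ι-+ c (suc (suc (j ℕ.+ j))))
         (cong (λ w → ι c + (1ℚ + (1ℚ + w))) (ι-+ j j)))
  eq : ι (suc j) * hahnFactor N (suc j) ≡ ι (suc c) * choose N j
  eq = modulo₂ 1ℚ (choose N j) (choose-step N j) N≡ (ring-eq (ι N) (ι j) (ι c) (choose N j) (choose N (suc j)))
    where
    ring-eq : ∀ N j c b₀ b₁ → (1ℚ + j) * (b₁ - b₀) ≡ (1ℚ + c) * b₀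
      + 1ℚ * ((1ℚ + j) * b₁ - (N - j) * b₀) + b₀ * (N - (c + (1ℚ + (1ℚ + (j + j)))))
    ring-eq = solve-∀ ℚ-ring

hahnFactor-binom : ∀ N j → binom (+ N) (+ j) - binom (+ N) (+ j ℤ.- + 1) ≡ hahnFactor N j
hahnFactor-binom N zero    = cong (_- 0ℚ) (binom≡choose N 0)
hahnFactor-binom N (suc j) = cong₂ _-_ (binom≡choose N (suc j)) (binom≡choose N j)

-- The quotient case receives any h with the defining property of the quotient, which keeps the
-- decision procedure and `÷'` out of later goals.
Hahn-elim : ∀ (T : ℚ → Set) i x N p →
  T (HahnContinuation i x N p) →
  (∀ h → h * (binom p (+ x) * binom (N ℤ.- p) (+ x)) ≡ binom N (+ i) - binom N (+ i ℤ.- + 1) →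
    T (h * Eberlein x (+ i) N p)) →
  T (Hahn i x N p)
Hahn-elim T i x N p f g with binom p (+ x) * binom (N ℤ.- p) (+ x) ℚ.≟ 0ℚ
... | yes _  = f
... | no  ≢0 = g (c ÷' d) (÷′-* c ≢0)
  where
  c d : ℚ
  c = binom N (+ i) - binom N (+ i ℤ.- + 1)
  d = binom p (+ x) * binom (N ℤ.- p) (+ x)

-- The continuation agrees with `hahnSum` coefficient by coefficient, since for ℓ ≤ j its divisors
-- are nonzero. In the other case the Eberlein sum is the denominator times `hahnSum`, and the
-- denominator cancels. Thus one polynomial in y covers both.
Hahn≡hahnSum : ∀ a b j y {N p} → N ≡ + ((j ℕ.+ a) ℕ.+ (j ℕ.+ b)) → p ≡ + (j ℕ.+ a) →
  Hahn j y N p ≡ hahnFactor ((j ℕ.+ a) ℕ.+ (j ℕ.+ b)) j * hahnSum a b j y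
Hahn≡hahnSum a b j y {N} {p} N≡ p≡ = Hahn-elim (_≡ F * hahnSum a b j y) j y N p
  (cong₂ _*_ factor≡ (sumTo-cong j λ ℓ ℓ≤j → cong₂ _*_ (coeff≡ ℓ ℓ≤j) (binom≡choose y ℓ)))
  λ h hD≡F′ → begin
    h * Eberlein y (+ j) N p    ≡⟨ cong (h *_) eberlein≡ ⟩
    h * (D * hahnSum a b j y)   ≡⟨ ℚ.*-assoc h D (hahnSum a b j y) ⟨
    h * D * hahnSum a b j y     ≡⟨ cong (_* hahnSum a b j y) (trans hD≡F′ factor≡) ⟩
    F * hahnSum a b j y         ∎
  where
  open ≡-Reasoning
  P M : ℕ
  P = j ℕ.+ a
  M = j ℕ.+ b
  F F′ D : ℚ
  F = hahnFactor (P ℕ.+ M) j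
  F′ = binom N (+ j) - binom N (+ j ℤ.- + 1)
  D = binom p (+ y) * binom (N ℤ.- p) (+ y)
  factor≡ : F′ ≡ F
  factor≡ = trans (cong (λ N → binom N (+ j) - binom N (+ j ℤ.- + 1)) N≡) (hahnFactor-binom (P ℕ.+ M) j)
  N-p≡ : N ℤ.- p ≡ + M
  N-p≡ = trans (cong₂ ℤ._-_ N≡ p≡) (trans (ℤ-monus (ℕ.m≤m+n P M)) (cong +_ (ℕ.m+n∸m≡n P M)))
  binom-p : ∀ ℓ → binom p (+ ℓ) ≡ choose P ℓ
  binom-p ℓ = trans (cong (λ z → binom z (+ ℓ)) p≡) (binom≡choose P ℓ)
  binom-N-p : ∀ ℓ → binom (N ℤ.- p) (+ ℓ) ≡ choose M ℓ
  binom-N-p ℓ = trans (cong (λ z → binom z (+ ℓ)) N-p≡) (binom≡choose M ℓ)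
  N+1-j≡ : N ℤ.+ + 1 ℤ.- + j ≡ + suc (j ℕ.+ (a ℕ.+ b))
  N+1-j≡ = trans (cong (λ z → z ℤ.+ + 1 ℤ.- + j) N≡)
    (trans (cong (λ z → + z ℤ.- + j) sum≡) (trans (ℤ-monus (ℕ.m≤m+n j _)) (cong +_ (ℕ.m+n∸m≡n j _))))
    where
    sum≡ : P ℕ.+ M ℕ.+ 1 ≡ j ℕ.+ suc (j ℕ.+ (a ℕ.+ b))
    sum≡ = ℕ-solve j a b
      where
      ℕ-solve : ∀ j a b → (j ℕ.+ a) ℕ.+ (j ℕ.+ b) ℕ.+ 1 ≡ j ℕ.+ (1 ℕ.+ (j ℕ.+ (a ℕ.+ b)))
      ℕ-solve = ℕ-solve-∀
  coeff≡ : ∀ ℓ → ℓ ℕ.≤ j →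
    sgn ℓ * binom (+ j) (+ ℓ) * (binom (N ℤ.+ + 1 ℤ.- + j) (+ ℓ) ÷' (binom p (+ ℓ) * binom (N ℤ.- p) (+ ℓ)))
    ≡ hahnCoeff a b j ℓ
  coeff≡ ℓ ℓ≤j = *-cancelˡ d d≢0 (begin
    d * (sgn ℓ * binom (+ j) (+ ℓ) * (binom (N ℤ.+ + 1 ℤ.- + j) (+ ℓ) ÷' (binom p (+ ℓ) * binom (N ℤ.- p) (+ ℓ))))
      ≡⟨ cong₂ (λ v w → d * (sgn ℓ * v * w)) (binom≡choose j ℓ)
           (cong₂ _÷'_ (trans (cong (λ z → binom z (+ ℓ)) N+1-j≡) (binom≡choose _ ℓ))
                       (cong₂ _*_ (binom-p ℓ) (binom-N-p ℓ))) ⟩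
    d * (sgn ℓ * choose j ℓ * (c ÷' d))
      ≡⟨ modulo₁ (sgn ℓ * choose j ℓ) (*-÷′ c d≢0) (ring-eq d (sgn ℓ) (choose j ℓ) (c ÷' d) c) ⟩
    sgn ℓ * choose j ℓ * c
      ≡⟨ hahnCoeff-formula a b j ℓ ⟨
    d * hahnCoeff a b j ℓ ∎)
    where
    c d : ℚ
    c = choose (suc (j ℕ.+ (a ℕ.+ b))) ℓ
    d = choose P ℓ * choose M ℓ
    d≢0 : d ≢ 0ℚ
    d≢0 = *-≢0 (choose≢0 (ℕ.≤-trans ℓ≤j (ℕ.m≤m+n j a))) (choose≢0 (ℕ.≤-trans ℓ≤j (ℕ.m≤m+n j b)))
    ring-eq : ∀ d s x q c → d * (s * x * q) ≡ s * x * c + s * x * (d * q - c)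
    ring-eq = solve-∀ ℚ-ring
  eberlein≡ : Eberlein y (+ j) N p ≡ D * hahnSum a b j y
  eberlein≡ = begin
    Eberlein y (+ j) N p ≡⟨ sumTo-cong y term ⟩
    conv (signedChoose j) (λ s → choose a s * choose b s) y ≡⟨ conv-signedChoose-hahnSum a b j y ⟩
    choose P y * choose M y * hahnSum a b j y
      ≡⟨ cong (_* hahnSum a b j y) (cong₂ _*_ (binom-p y) (binom-N-p y)) ⟨
    D * hahnSum a b j y ∎
    where
    minus-j : ∀ {z} c → z ≡ + (j ℕ.+ c) → z ℤ.- + j ≡ + c
    minus-j c refl = trans (ℤ-monus (ℕ.m≤m+n j c)) (cong +_ (ℕ.m+n∸m≡n j c))
    term : ∀ ℓ → ℓ ℕ.≤ y →
      sgn ℓ * binom (+ j) (+ ℓ) * binom (p ℤ.- + j) (+ y ℤ.- + ℓ) * binom (N ℤ.- p ℤ.- + j) (+ y ℤ.- + ℓ)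
      ≡ signedChoose j ℓ * (choose a (y ∸ ℓ) * choose b (y ∸ ℓ))
    term ℓ ℓ≤y = begin
      sgn ℓ * binom (+ j) (+ ℓ) * binom (p ℤ.- + j) (+ y ℤ.- + ℓ) * binom (N ℤ.- p ℤ.- + j) (+ y ℤ.- + ℓ)
        ≡⟨ cong₂ _*_ (cong₂ _*_ (cong (sgn ℓ *_) (binom≡choose j ℓ))
             (trans (cong₂ binom (minus-j a p≡) (ℤ-monus ℓ≤y)) (binom≡choose a (y ∸ ℓ))))
             (trans (cong₂ binom (minus-j b N-p≡) (ℤ-monus ℓ≤y)) (binom≡choose b (y ∸ ℓ))) ⟩
      signedChoose j ℓ * choose a (y ∸ ℓ) * choose b (y ∸ ℓ)
        ≡⟨ ℚ.*-assoc (signedChoose j ℓ) (choose a (y ∸ ℓ)) (choose b (y ∸ ℓ)) ⟩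
      signedChoose j ℓ * (choose a (y ∸ ℓ) * choose b (y ∸ ℓ)) ∎

-- Compatible polynomials

infixl 6 _⊕_
_⊕_ : ℕ × ℕ → ℕ × ℕ → ℕ × ℕ
(a , b) ⊕ (c , d) = (a ℕ.+ c , b ℕ.+ d)

-- ≼ is the order ≼_(0,½) with the second inequality doubled, and a ≺ b holds iff a ≼ b and a ≢ b:
-- adding up the two inequalities of a ≼ b, equality of the coordinate sums forces a ≡ b.
infix 4 _≼_ _≺_
_≼_ : ℕ × ℕ → ℕ × ℕ → Set
(a , b) ≼ (i , j) = a ℕ.≤ i × a ℕ.+ 2 ℕ.* b ℕ.≤ i ℕ.+ 2 ℕ.* j

_≺_ : ℕ × ℕ → ℕ × ℕ → Set
(a , b) ≺ (i , j) = (a , b) ≼ (i , j) × a ℕ.+ b ℕ.< i ℕ.+ j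

≺-irrefl : ∀ {d} → ¬ (d ≺ d)
≺-irrefl (_ , lt) = ℕ.<-irrefl refl lt

≺-trans : ∀ {c d e} → c ≺ d → d ≺ e → c ≺ e
≺-trans ((p , q) , r) ((p′ , q′) , r′) = (ℕ.≤-trans p p′ , ℕ.≤-trans q q′) , ℕ.<-trans r r′

⊕-monoʳ-≺ : ∀ e {c d} → c ≺ d → e ⊕ c ≺ e ⊕ d
⊕-monoʳ-≺ (x , y) {a , b} {i , j} ((p , q) , r) =
  ( ℕ.+-monoʳ-≤ x p
  , subst₂ ℕ._≤_ (sym (interchange₂ x y a b)) (sym (interchange₂ x y i j)) (ℕ.+-monoʳ-≤ (x ℕ.+ 2 ℕ.* y) q) )
  , subst₂ ℕ._<_ (sym (interchange₁ x y a b)) (sym (interchange₁ x y i j)) (ℕ.+-monoʳ-< (x ℕ.+ y) r)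
  where
  interchange₁ : ∀ x y a b → (x ℕ.+ a) ℕ.+ (y ℕ.+ b) ≡ (x ℕ.+ y) ℕ.+ (a ℕ.+ b)
  interchange₁ = ℕ-solve-∀
  interchange₂ : ∀ x y a b → (x ℕ.+ a) ℕ.+ 2 ℕ.* (y ℕ.+ b) ≡ (x ℕ.+ 2 ℕ.* y) ℕ.+ (a ℕ.+ 2 ℕ.* b)
  interchange₂ = ℕ-solve-∀

⊕-comm : ∀ d e → d ⊕ e ≡ e ⊕ d
⊕-comm (a , b) (c , d) = cong₂ _,_ (ℕ.+-comm a c) (ℕ.+-comm b d)

⊕-monoˡ-≺ : ∀ e {c d} → c ≺ d → c ⊕ e ≺ d ⊕ e
⊕-monoˡ-≺ e {c} {d} c≺d = subst₂ _≺_ (⊕-comm e c) (⊕-comm e d) (⊕-monoʳ-≺ e c≺d)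

monomial : ℕ × ℕ → ℚ → ℚ → ℚ
monomial (a , b) u v = (u ^ℚ a) * (v ^ℚ b)

^ℚ-+ : ∀ u a b → u ^ℚ (a ℕ.+ b) ≡ (u ^ℚ a) * (u ^ℚ b)
^ℚ-+ u zero    b = sym (ℚ.*-identityˡ (u ^ℚ b))
^ℚ-+ u (suc a) b = trans (cong (u *_) (^ℚ-+ u a b)) (sym (ℚ.*-assoc u (u ^ℚ a) (u ^ℚ b)))

monomial-⊕ : ∀ d e u v → monomial (d ⊕ e) u v ≡ monomial d u v * monomial e u v
monomial-⊕ (a , b) (c , d) u v = trans (cong₂ _*_ (^ℚ-+ u a c) (^ℚ-+ v b d))
  (ring-eq (u ^ℚ a) (u ^ℚ c) (v ^ℚ b) (v ^ℚ d))
  where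
  ring-eq : ∀ a c b d → a * c * (b * d) ≡ a * b * (c * d)
  ring-eq = solve-∀ ℚ-ring

eval : Poly → ℚ → ℚ → ℚ
eval []            u v = 0ℚ
eval ((c , d) ∷ p) u v = c * monomial d u v + eval p u v

eval-++ : ∀ p q u v → eval (p ++ q) u v ≡ eval p u v + eval q u v
eval-++ []            q u v = sym (ℚ.+-identityˡ (eval q u v))
eval-++ ((c , d) ∷ p) q u v = trans (cong (λ w → c * monomial d u v + w) (eval-++ p q u v))
  (sym (ℚ.+-assoc (c * monomial d u v) (eval p u v) (eval q u v)))

mulTerm : ℚ → ℕ × ℕ → Poly → Poly
mulTerm c d = map λ where (c′ , d′) → c * c′ , d ⊕ d′

eval-mulTerm : ∀ c d p u v → eval (mulTerm c d p) u v ≡ c * monomial d u v * eval p u v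
eval-mulTerm c d []              u v = sym (ℚ.*-zeroʳ (c * monomial d u v))
eval-mulTerm c d ((c′ , d′) ∷ p) u v =
  trans (cong₂ (λ m w → c * c′ * m + w) (monomial-⊕ d d′ u v) (eval-mulTerm c d p u v))
    (ring-eq c c′ (monomial d u v) (monomial d′ u v) (eval p u v))
  where
  ring-eq : ∀ c c′ m m′ e → c * c′ * (m * m′) + c * m * e ≡ c * m * (c′ * m′ + e)
  ring-eq = solve-∀ ℚ-ring

-- Functions with a leading monomial in two generators

module _ {X : Set} (U V : X → ℚ) where

  -- `Lower` also admits the zero function and cancelling terms; `HasDegree` keeps its leading
  -- coefficient apart from such a remainder, so adding a `Lower` part never disturbs it.
  record Lower (d : ℕ × ℕ) (f : X → ℚ) : Set where
    constructor lower
    field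
      poly  : Poly
      terms : All (λ (_ , e) → e ≺ d) poly
      value : ∀ x → f x ≡ eval poly (U x) (V x)

  record HasDegree (d : ℕ × ℕ) (f : X → ℚ) : Set where
    constructor hasDegree
    field
      lead   : ℚ
      lead≢0 : lead ≢ 0ℚ
      rest   : Poly
      terms  : All (λ (_ , e) → e ≺ d) rest
      value  : ∀ x → f x ≡ eval ((lead , d) ∷ rest) (U x) (V x)

  Lower-cong : ∀ {d f g} → (∀ x → g x ≡ f x) → Lower d f → Lower d g
  Lower-cong eq (lower p t v) = lower p t (λ x → trans (eq x) (v x))

  HasDegree-cong : ∀ {d f g} → (∀ x → g x ≡ f x) → HasDegree d f → HasDegree d g
  HasDegree-cong eq (hasDegree c c≢0 p t v) = hasDegree c c≢0 p t (λ x → trans (eq x) (v x))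

  Lower-zero : ∀ {d} → Lower d (λ _ → 0ℚ)
  Lower-zero = lower [] [] (λ _ → refl)

  Lower-+ : ∀ {d f g} → Lower d f → Lower d g → Lower d (λ x → f x + g x)
  Lower-+ (lower p t v) (lower p′ t′ v′) = lower (p ++ p′) (All.++⁺ t t′)
    (λ x → trans (cong₂ _+_ (v x) (v′ x)) (sym (eval-++ p p′ (U x) (V x))))

  Lower-mulTerm : ∀ {d f} c e → Lower d f → Lower (e ⊕ d) (λ x → c * monomial e (U x) (V x) * f x)
  Lower-mulTerm c e (lower p t v) = lower (mulTerm c e p) (All.map⁺ (All.map (⊕-monoʳ-≺ e) t))
    (λ x → trans (cong (c * monomial e (U x) (V x) *_) (v x)) (sym (eval-mulTerm c e p (U x) (V x))))

  Lower-scale : ∀ {d f} c → Lower d f → Lower d (λ x → c * f x)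
  Lower-scale {f = f} c l = Lower-cong (λ x → ring-eq c (f x)) (Lower-mulTerm c (0 , 0) l)
    where
    ring-eq : ∀ c y → c * y ≡ c * (1ℚ * 1ℚ) * y
    ring-eq = solve-∀ ℚ-ring

  HasDegree-lower : ∀ {d e f} → d ≺ e → HasDegree d f → Lower e f
  HasDegree-lower {d} d≺e (hasDegree c _ p t v) =
    lower ((c , d) ∷ p) (d≺e ∷ All.map (λ e≺d → ≺-trans e≺d d≺e) t) v

  HasDegree-mulTerm : ∀ {d f} c e → c ≢ 0ℚ → HasDegree d f →
    HasDegree (e ⊕ d) (λ x → c * monomial e (U x) (V x) * f x)
  HasDegree-mulTerm {d} c e c≢0 (hasDegree c′ c′≢0 p t v) =
    hasDegree (c * c′) (*-≢0 c≢0 c′≢0) (mulTerm c e p) (All.map⁺ (All.map (⊕-monoʳ-≺ e) t))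
      (λ x → trans (cong (c * monomial e (U x) (V x) *_) (v x)) (sym (eval-mulTerm c e ((c′ , d) ∷ p) (U x) (V x))))

  HasDegree-scale : ∀ {d f} c → c ≢ 0ℚ → HasDegree d f → HasDegree d (λ x → c * f x)
  HasDegree-scale {f = f} c c≢0 h = HasDegree-cong (λ x → ring-eq c (f x)) (HasDegree-mulTerm c (0 , 0) c≢0 h)
    where
    ring-eq : ∀ c y → c * y ≡ c * (1ℚ * 1ℚ) * y
    ring-eq = solve-∀ ℚ-ring

  HasDegree-+ : ∀ {d f g} → HasDegree d f → Lower d g → HasDegree d (λ x → f x + g x)
  HasDegree-+ {d} (hasDegree c c≢0 p t v) (lower p′ t′ v′) = hasDegree c c≢0 (p ++ p′) (All.++⁺ t t′)
    (λ x → trans (cong₂ _+_ (v x) (v′ x)) (sym (eval-++ ((c , d) ∷ p) p′ (U x) (V x))))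

  HasDegree-monomial : ∀ c d → c ≢ 0ℚ → HasDegree d (λ x → c * monomial d (U x) (V x))
  HasDegree-monomial c d c≢0 = hasDegree c c≢0 [] [] (λ x → sym (ℚ.+-identityʳ (c * monomial d (U x) (V x))))

  HasDegree-const : ∀ c → c ≢ 0ℚ → HasDegree (0 , 0) (λ _ → c)
  HasDegree-const c c≢0 = HasDegree-cong (λ _ → sym (ℚ.*-identityʳ c)) (HasDegree-monomial c (0 , 0) c≢0)

  Lower-const : ∀ {d} c → (0 , 0) ≺ d → Lower d (λ _ → c)
  Lower-const c 0≺d = Lower-cong (λ _ → ring-eq c) (Lower-scale c (HasDegree-lower 0≺d (HasDegree-const 1ℚ 1≢0)))
    where
    ring-eq : ∀ c → c ≡ c * 1ℚ
    ring-eq = solve-∀ ℚ-ring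

  -- The product of the leading terms survives because ℚ has no zero divisors; all other products
  -- lie strictly below, since `≺` is preserved by adding exponents.
  HasDegree-* : ∀ {d e f g} → HasDegree d f → HasDegree e g → HasDegree (d ⊕ e) (λ x → f x * g x)
  HasDegree-* {d} {e} {f} {g} (hasDegree c c≢0 p t v) h = HasDegree-cong
    (λ x → trans (cong (_* g x) (v x)) (ℚ.*-distribʳ-+ (g x) (c * monomial d (U x) (V x)) (eval p (U x) (V x))))
    (HasDegree-+ (HasDegree-mulTerm c d c≢0 h) (rest t))
    where
    rest : ∀ {p} → All (λ (_ , d′) → d′ ≺ d) p → Lower (d ⊕ e) (λ x → eval p (U x) (V x) * g x)
    rest [] = Lower-cong (λ x → ℚ.*-zeroˡ (g x)) Lower-zero
    rest {(c′ , d′) ∷ p} (d′≺d ∷ t) = Lower-cong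
      (λ x → ring-eq c′ (monomial d′ (U x) (V x)) (eval p (U x) (V x)) (g x))
      -- The coefficient `c′` may be zero, so the monomial is multiplied in with coefficient 1 and
      -- `c′` is applied afterwards.
      (Lower-+ (Lower-scale c′ (HasDegree-lower (⊕-monoˡ-≺ e d′≺d) (HasDegree-mulTerm 1ℚ d′ 1≢0 h))) (rest t))
      where
      ring-eq : ∀ c m p g → (c * m + p) * g ≡ c * (1ℚ * m * g) + p * g
      ring-eq = solve-∀ ℚ-ring

  module _ (Y : X → ℕ) (Y-degree : HasDegree (0 , 1) (λ x → ι (Y x))) where

    choose-degree : ∀ ℓ → HasDegree (0 , ℓ) (λ x → choose (Y x) ℓ)
    choose-degree zero    = HasDegree-const 1ℚ 1≢0
    choose-degree (suc ℓ) = HasDegree-cong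
      (λ x → *-cancelˡ (ι (suc ℓ)) (ι-suc≢0 ℓ)
        (trans (choose-step (Y x) ℓ) (modulo₁ (- ((ι (Y x) - ι ℓ) * choose (Y x) ℓ)) (*-÷′ 1ℚ (ι-suc≢0 ℓ))
          (ring-eq (ι (suc ℓ)) (1ℚ ÷' ι (suc ℓ)) (ι (Y x)) (ι ℓ) (choose (Y x) ℓ)))))
      (HasDegree-scale (1ℚ ÷' ι (suc ℓ)) (÷′-≢0 1≢0 (ι-suc≢0 ℓ))
        (HasDegree-* (HasDegree-+ Y-degree (Lower-const (- ι ℓ) ((ℕ.z≤n , ℕ.z≤n) , ℕ.s≤s ℕ.z≤n))) (choose-degree ℓ)))
      where
      ring-eq : ∀ s r y l c → (y - l) * c ≡ s * (r * ((y + (- l)) * c)) + (- ((y - l) * c)) * (s * r - 1ℚ)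
      ring-eq = solve-∀ ℚ-ring

    newton-lower : ∀ (h : ℕ → ℚ) i j → i ℕ.< j → Lower (0 , j) (λ x → sumTo i (λ ℓ → h ℓ * choose (Y x) ℓ))
    newton-lower h i j i<j = go i i<j
      where
      term : ∀ {ℓ} → ℓ ℕ.< j → Lower (0 , j) (λ x → h ℓ * choose (Y x) ℓ)
      term {ℓ} ℓ<j = Lower-scale (h ℓ)
        (HasDegree-lower ((ℕ.z≤n , ℕ.*-monoʳ-≤ 2 (ℕ.<⇒≤ ℓ<j)) , ℓ<j) (choose-degree ℓ))
      go : ∀ i → i ℕ.< j → Lower (0 , j) (λ x → sumTo i (λ ℓ → h ℓ * choose (Y x) ℓ))
      go zero    0<j = term 0<j
      go (suc i) i<j = Lower-+ (go i (ℕ.<⇒≤ i<j)) (term i<j)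

    newton-degree : ∀ (h : ℕ → ℚ) j → h j ≢ 0ℚ → HasDegree (0 , j) (λ x → sumTo j (λ ℓ → h ℓ * choose (Y x) ℓ))
    newton-degree h zero    h≢0 = HasDegree-scale (h 0) h≢0 (choose-degree 0)
    newton-degree h (suc j) h≢0 = HasDegree-cong
      (λ x → ℚ.+-comm (sumTo j (λ ℓ → h ℓ * choose (Y x) ℓ)) (h (suc j) * choose (Y x) (suc j)))
      (HasDegree-+ (HasDegree-scale (h (suc j)) h≢0 (choose-degree (suc j))) (newton-lower h j (suc j) (ℕ.n<1+n j)))

    -- The recurrence reaches back two steps, so the induction also carries its last term, the
    -- earlier value times w + 1 - i. That product must stay below (i + 1, 0), and it is 0 at the
    -- start.
    krawtchouk-degree : ∀ t c (u : X → ℚ) (f : X → ℕ → ℚ) → HasDegree (1 , 0) u →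
      (∀ x → f x 0 ≡ 1ℚ) → (∀ x → KrawtchoukRec t (u x) (c - ι (Y x)) (f x)) →
      ∀ i → HasDegree (i , 0) (λ x → f x i)
    krawtchouk-degree t c u f u-degree f₀ rec i = proj₁ (go i)
      where
      go : ∀ i → HasDegree (i , 0) (λ x → f x i)
               × Lower (suc i , 0) (λ x → (c - ι (Y x) + 1ℚ - ι i) * pad (f x) i)
      go zero = HasDegree-cong f₀ (HasDegree-const 1ℚ 1≢0)
              , Lower-cong (λ x → ℚ.*-zeroʳ (c - ι (Y x) + 1ℚ - 0ℚ)) Lower-zero
      go (suc i) with go i
      ... | f-degree , f-lower =
          HasDegree-cong
            (λ x → *-cancelˡ (ι (suc i)) (ι-suc≢0 i) (trans (rec x i)
              (modulo₁ (- rhs x) (*-÷′ 1ℚ (ι-suc≢0 i))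
                (ring-eq (ι (suc i)) (1ℚ ÷' ι (suc i)) t (u x) (ι i) (f x i) (c - ι (Y x) + 1ℚ - ι i) (pad (f x) i)))))
            (HasDegree-scale (1ℚ ÷' ι (suc i)) (÷′-≢0 1≢0 (ι-suc≢0 i))
              (HasDegree-+ (HasDegree-* u-degree f-degree)
                (Lower-+ (Lower-scale (- ((t - 1ℚ) * ι i)) (HasDegree-lower i≺1+i f-degree))
                         (Lower-scale (- t) f-lower))))
        , HasDegree-lower i,1≺2+i,0 (HasDegree-* w-degree f-degree)
        where
        rhs : X → ℚ
        rhs x = (u x - (t - 1ℚ) * ι i) * f x i - t * (c - ι (Y x) + 1ℚ - ι i) * pad (f x) i
        ring-eq : ∀ s r t u i f w g → (u - (t - 1ℚ) * i) * f - t * w * g ≡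
          s * (r * (u * f + ((- ((t - 1ℚ) * i)) * f + (- t) * (w * g))))
          + (- ((u - (t - 1ℚ) * i) * f - t * w * g)) * (s * r - 1ℚ)
        ring-eq = solve-∀ ℚ-ring
        w-eq : ∀ c y i → c - y + 1ℚ - i ≡ (- 1ℚ) * y + (c + 1ℚ - i)
        w-eq = solve-∀ ℚ-ring
        w-degree : HasDegree (0 , 1) (λ x → c - ι (Y x) + 1ℚ - ι (suc i))
        w-degree = HasDegree-cong (λ x → w-eq c (ι (Y x)) (ι (suc i)))
          (HasDegree-+ (HasDegree-scale (- 1ℚ) (λ ()) Y-degree)
            (Lower-const (c + 1ℚ - ι (suc i)) ((ℕ.z≤n , ℕ.z≤n) , ℕ.s≤s ℕ.z≤n)))
        i≺1+i : (i , 0) ≺ (suc i , 0)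
        i≺1+i = (ℕ.n≤1+n i , ℕ.n≤1+n _) , ℕ.n<1+n _
        -- The weights a + 2b agree, so this is tight for β = ½; strictness comes from the
        -- coordinate sum.
        i,1≺2+i,0 : (i , 1) ≺ (suc (suc i) , 0)
        i,1≺2+i,0 = (ℕ.m≤n⇒m≤1+n (ℕ.n≤1+n i) , ℕ.≤-reflexive (weight-eq i)) , ℕ.≤-reflexive (sum-eq i)
          where
          weight-eq : ∀ i → i ℕ.+ 2 ≡ 2 ℕ.+ i ℕ.+ 0
          weight-eq = ℕ-solve-∀
          sum-eq : ∀ i → 1 ℕ.+ (i ℕ.+ 1) ≡ 2 ℕ.+ i ℕ.+ 0
          sum-eq = ℕ-solve-∀

-- The rational order, the region 𝒟 and coefficients

ι-nonNeg : ∀ a → 0ℚ ℚ.≤ ι a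
ι-nonNeg zero    = ℚ.≤-refl
ι-nonNeg (suc a) = ℚ.+-mono-≤ (ℚ.nonNegative⁻¹ 1ℚ) (ι-nonNeg a)

ι-mono-≤ : ∀ {a b} → a ℕ.≤ b → ι a ℚ.≤ ι b
ι-mono-≤ {b = b} ℕ.z≤n     = ι-nonNeg b
ι-mono-≤ (ℕ.s≤s a≤b) = ℚ.+-monoʳ-≤ 1ℚ (ι-mono-≤ a≤b)

ι-mono-< : ∀ {a b} → a ℕ.< b → ι a ℚ.< ι b
ι-mono-< {a} a<b = ℚ.<-≤-trans (subst (ℚ._< ι (suc a)) (ℚ.+-identityˡ (ι a))
  (ℚ.+-mono-<-≤ (ℚ.positive⁻¹ 1ℚ) (ℚ.≤-refl {ι a}))) (ι-mono-≤ a<b)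

ι-cancel-≤ : ∀ {a b} → ι a ℚ.≤ ι b → a ℕ.≤ b
ι-cancel-≤ {a} {b} le = ℕ.≮⇒≥ (λ b<a → ℚ.<-irrefl refl (ℚ.<-≤-trans (ι-mono-< b<a) le))

Preceq-fst : ∀ a b → ℕtoℚ a + 0ℚ * ℕtoℚ b ≡ ι a
Preceq-fst a b = trans (cong (λ w → ℕtoℚ a + w) (ℚ.*-zeroˡ (ℕtoℚ b)))
  (trans (ℚ.+-identityʳ (ℕtoℚ a)) (sym (ι≡ℕtoℚ a)))

Preceq-snd : ∀ a b → ½ * ℕtoℚ a + ℕtoℚ b ≡ ½ * ι (a ℕ.+ 2 ℕ.* b)
Preceq-snd a b = begin
  ½ * ℕtoℚ a + ℕtoℚ b         ≡⟨ cong₂ (λ v w → ½ * v + w) (ι≡ℕtoℚ a) (ι≡ℕtoℚ b) ⟨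
  ½ * ι a + ι b               ≡⟨ ring-eq (ι a) (ι b) ⟩
  ½ * (ι a + ι 2 * ι b)       ≡⟨ cong (½ *_) (trans (ι-+ a (2 ℕ.* b)) (cong (λ w → ι a + w) (ι-* 2 b))) ⟨
  ½ * ι (a ℕ.+ 2 ℕ.* b)       ∎
  where
  open ≡-Reasoning
  ring-eq : ∀ a b → ½ * a + b ≡ ½ * (a + ι 2 * b)
  ring-eq = solve-∀ ℚ-ring

≼⇒Preceq : ∀ {c d} → c ≼ d → Preceq 0ℚ ½ c d
≼⇒Preceq {a , b} {i , j} (p , q) =
    subst₂ ℚ._≤_ (sym (Preceq-fst a b)) (sym (Preceq-fst i j)) (ι-mono-≤ p)
  , subst₂ ℚ._≤_ (sym (Preceq-snd a b)) (sym (Preceq-snd i j)) (ℚ.*-monoˡ-≤-nonNeg ½ (ι-mono-≤ q))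

Preceq⇒≼ : ∀ {c d} → Preceq 0ℚ ½ c d → c ≼ d
Preceq⇒≼ {a , b} {i , j} (p , q) =
    ι-cancel-≤ (subst₂ ℚ._≤_ (Preceq-fst a b) (Preceq-fst i j) p)
  , ι-cancel-≤ (ℚ.*-cancelˡ-≤-pos ½ (subst₂ ℚ._≤_ (Preceq-snd a b) (Preceq-snd i j) q))

-- Adding the two inequalities gives 2(a + b) ≤ 2(i + j) ≤ 2k. For b ≤ n - k: if b < k, then b + k ≤
-- 2k - 1 ≤ n; otherwise i + j ≤ k ≤ b, so 2b ≤ i + 2j ≤ b + j and b ≤ j ≤ n - k.
InD-downward : ∀ {k n} → 2 ℕ.* k ∸ 1 ℕ.≤ n → ∀ {c d} → InD k n d → c ≼ d → InD k n c
InD-downward {k} {n} 2k-1≤n {a , b} {i , j} (i+j≤k , j≤k , j≤n-k) (a≤i , a+2b≤i+2j) = a+b≤k , b≤k , b≤n-k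
  where
  open ℕ.≤-Reasoning
  double : ∀ a b → 2 ℕ.* (a ℕ.+ b) ≡ a ℕ.+ (a ℕ.+ 2 ℕ.* b)
  double = ℕ-solve-∀
  a+b≤k : a ℕ.+ b ℕ.≤ k
  a+b≤k = ℕ.*-cancelˡ-≤ 2 (begin
    2 ℕ.* (a ℕ.+ b)         ≡⟨ double a b ⟩
    a ℕ.+ (a ℕ.+ 2 ℕ.* b)   ≤⟨ ℕ.+-mono-≤ a≤i a+2b≤i+2j ⟩
    i ℕ.+ (i ℕ.+ 2 ℕ.* j)   ≡⟨ double i j ⟨
    2 ℕ.* (i ℕ.+ j)         ≤⟨ ℕ.*-monoʳ-≤ 2 i+j≤k ⟩
    2 ℕ.* k                 ∎)
  b≤k : b ℕ.≤ k
  b≤k = ℕ.≤-trans (ℕ.m≤n+m b a) a+b≤k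
  b≤n-k : b ℕ.≤ n ∸ k
  b≤n-k with b ℕ.<? k
  ... | yes b<k = ℕ.m+n≤o⇒m≤o∸n b (begin
    b ℕ.+ k                 ≤⟨ ℕ.+-monoˡ-≤ k (ℕ.<⇒≤pred b<k) ⟩
    ℕ.pred k ℕ.+ k          ≡⟨ pred-double b<k ⟩
    2 ℕ.* k ∸ 1             ≤⟨ 2k-1≤n ⟩
    n                       ∎)
    where
    pred-double : ∀ {k} → b ℕ.< k → ℕ.pred k ℕ.+ k ≡ 2 ℕ.* k ∸ 1
    pred-double {suc k} _ = cong (λ w → k ℕ.+ suc w) (sym (ℕ.+-identityʳ k))
  ... | no  b≮k = ℕ.≤-trans (ℕ.+-cancelˡ-≤ b b j (begin
    b ℕ.+ b                 ≡⟨ cong (λ w → b ℕ.+ w) (ℕ.+-identityʳ b) ⟨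
    2 ℕ.* b                 ≤⟨ ℕ.m≤n+m (2 ℕ.* b) a ⟩
    a ℕ.+ 2 ℕ.* b           ≤⟨ a+2b≤i+2j ⟩
    i ℕ.+ 2 ℕ.* j           ≡⟨ regroup i j ⟩
    (i ℕ.+ j) ℕ.+ j         ≤⟨ ℕ.+-monoˡ-≤ j (ℕ.≤-trans i+j≤k (ℕ.≮⇒≥ b≮k)) ⟩
    b ℕ.+ j                 ∎)) j≤n-k
    where
    regroup : ∀ i j → i ℕ.+ 2 ℕ.* j ≡ (i ℕ.+ j) ℕ.+ j
    regroup = ℕ-solve-∀

-- A list may repeat a monomial and its terms may cancel, but a nonzero total needs at least one
-- listed term with that exponent.
coeff-elim : ∀ {T : ℕ × ℕ → Set} p a b → All (λ (_ , d) → T d) p → coeff p a b ≢ 0ℚ → T (a , b)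
coeff-elim []                  a b []      ≢0 = contradiction refl ≢0
coeff-elim ((c , a′ , b′) ∷ p) a b (t ∷ ts) ≢0 with a′ ℕ.≟ a | b′ ℕ.≟ b
... | yes refl | yes refl = t
... | yes _    | no  _    = coeff-elim p a b ts (λ eq → ≢0 (trans (ℚ.+-identityˡ (coeff p a b)) eq))
... | no  _    | _        = coeff-elim p a b ts (λ eq → ≢0 (trans (ℚ.+-identityˡ (coeff p a b)) eq))

-- By irreflexivity of `≺` no listed exponent is (i, j) itself; hence the remainder cannot cancel
-- the leading coefficient.
coeff-lower : ∀ p i j → All (λ (_ , d) → d ≺ (i , j)) p → coeff p i j ≡ 0ℚ
coeff-lower p i j ts with coeff p i j ℚ.≟ 0ℚ
... | yes eq = eq
... | no  ≢0 = contradiction (coeff-elim {_≺ (i , j)} p i j ts ≢0) ≺-irrefl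

coeff-head : ∀ c i j p → coeff ((c , i , j) ∷ p) i j ≡ c + coeff p i j
coeff-head c i j p with i ℕ.≟ i | j ℕ.≟ j
... | yes _  | yes _  = refl
... | yes _  | no j≢j = contradiction refl j≢j
... | no i≢i | _      = contradiction refl i≢i

compatible : ∀ c p i j → c ≢ 0ℚ → All (λ (_ , d) → d ≺ (i , j)) p →
  CompatiblePoly 0ℚ ½ ((c , i , j) ∷ p) i j
compatible c p i j c≢0 ts =
    (λ eq → c≢0 (trans (sym (trans (coeff-head c i j p)
      (trans (cong (λ w → c + w) (coeff-lower p i j ts)) (ℚ.+-identityʳ c)))) eq))
  , λ a b ≢0 → ≼⇒Preceq {a , b} {i , j}
      (coeff-elim {_≼ (i , j)} ((c , i , j) ∷ p) a b ((ℕ.≤-refl , ℕ.≤-refl) ∷ All.map proj₁ ts) ≢0)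

evalH≡eval : ∀ {r k n} p (A B : Matrix r k n) u v → evalH p A B u v ≡ eval p (A u v) (B u v)
evalH≡eval []                A B u v = refl
evalH≡eval ((c , a , b) ∷ p) A B u v =
  cong₂ (λ m w → c * m + w) (cong₂ _*_ (^H≡^ℚ A a) (^H≡^ℚ B b)) (evalH≡eval p A B u v)
  where
  ^H≡^ℚ : ∀ A m → (A ^H m) u v ≡ A u v ^ℚ m
  ^H≡^ℚ A zero    = refl
  ^H≡^ℚ A (suc m) = cong (A u v *_) (^H≡^ℚ A m)

-- The relations of the scheme

count-mono : ∀ {n} {P Q : Fin n → Bool} → (∀ i → P i ≡ true → Q i ≡ true) → count P ℕ.≤ count Q
count-mono {zero}          imp = ℕ.z≤n
count-mono {suc n} {P} {Q} imp = ℕ.+-mono-≤ (head (imp Fin.zero)) (count-mono (λ i → imp (Fin.suc i)))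
  where
  head : ∀ {p q} → (p ≡ true → q ≡ true) → (if p then 1 else 0) ℕ.≤ (if q then 1 else 0)
  head {false}        _   = ℕ.z≤n
  head {true} {true}  _   = ℕ.≤-refl
  head {true} {false} imp = contradiction (imp refl) λ ()

-- Inclusion-exclusion: the union of the two sets has at most n elements.
count-∧ : ∀ {n} (P Q : Fin n → Bool) → count P ℕ.+ count Q ℕ.≤ n ℕ.+ count (λ i → P i ∧ Q i)
count-∧ {zero}  P Q = ℕ.z≤n
count-∧ {suc n} P Q = subst₂ ℕ._≤_ (interchange p₀ q₀ (count P′) (count Q′)) (interchange 1 r₀ n (count (λ i → P′ i ∧ Q′ i)))
  (ℕ.+-mono-≤ (head (P Fin.zero) (Q Fin.zero)) (count-∧ P′ Q′))
  where
  P′ Q′ : Fin n → Bool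
  P′ i = P (Fin.suc i)
  Q′ i = Q (Fin.suc i)
  p₀ q₀ r₀ : ℕ
  p₀ = if P Fin.zero then 1 else 0
  q₀ = if Q Fin.zero then 1 else 0
  r₀ = if P Fin.zero ∧ Q Fin.zero then 1 else 0
  interchange : ∀ a b c d → (a ℕ.+ b) ℕ.+ (c ℕ.+ d) ≡ (a ℕ.+ c) ℕ.+ (b ℕ.+ d)
  interchange = ℕ-solve-∀
  head : ∀ p q → (if p then 1 else 0) ℕ.+ (if q then 1 else 0) ℕ.≤ 1 ℕ.+ (if p ∧ q then 1 else 0)
  head true  true  = ℕ.≤-refl
  head true  false = ℕ.≤-refl
  head false true  = ℕ.≤-refl
  head false false = ℕ.z≤n

eC≤cC : ∀ {n r} (x y : Fin n → Fin r) → eC x y ℕ.≤ cC x y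
eC≤cC x y = count-mono (λ i → imp (x i) (y i))
  where
  imp : ∀ a b → ⌊ a Fin.≟ b ⌋ ∧ nonzero a ≡ true → nonzero a ∧ nonzero b ≡ true
  imp a b eq with a Fin.≟ b
  ... | yes refl = cong₂ _∧_ eq eq

cC≤weight : ∀ {n r} (x y : Fin n → Fin r) → cC x y ℕ.≤ weight x
cC≤weight x y = count-mono (λ i → imp (nonzero (x i)) (nonzero (y i)))
  where
  imp : ∀ a b → a ∧ b ≡ true → a ≡ true
  imp true _ _ = refl

sumTo-single : ∀ k {i} f → i ℕ.≤ k → (∀ ℓ → ℓ ≢ i → f ℓ ≡ 0ℚ) → sumTo k f ≡ f i
sumTo-single zero    f ℕ.z≤n _ = refl
sumTo-single (suc k) {i} f i≤1+k off with i ℕ.≟ suc k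
... | yes refl = trans (cong (_+ f (suc k)) (sumTo-zero k (λ ℓ ℓ≤k → off ℓ (ℕ.<⇒≢ (ℕ.s≤s ℓ≤k)))))
                       (ℚ.+-identityˡ (f (suc k)))
... | no  i≢1+k = trans (cong₂ _+_ (sumTo-single k f (ℕ.≤-pred (ℕ.≤∧≢⇒< i≤1+k i≢1+k)) off) (off (suc k) (i≢1+k ∘ sym)))
                        (ℚ.+-identityʳ (f i))

Region : ℕ → ℕ → Set
Region k n = Σ[ d ∈ ℕ × ℕ ] InD k n d

∸-telescope : ∀ {e c k} → e ℕ.≤ c → c ℕ.≤ k → (c ∸ e) ℕ.+ (k ∸ c) ≡ k ∸ e
∸-telescope {e} {c} {k} e≤c c≤k = trans (ℕ.+-comm (c ∸ e) (k ∸ c))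
  (trans (sym (ℕ.+-∸-assoc (k ∸ c) e≤c)) (cong (_∸ e) (ℕ.m∸n+n≡m c≤k)))

module _ {r k n : ℕ} (k≤n : k ℕ.≤ n) where

  cC≤k : (u v : S r k n) → cC (proj₁ u) (proj₁ v) ℕ.≤ k
  cC≤k (x , wx) (y , _) = subst (cC x y ℕ.≤_) wx (cC≤weight x y)

  -- The solution (a, b) of e = k - a - b and c = k - b. Here a + b = k - e, and b ≤ n - k because
  -- two supports of size k among n positions share at least 2k - n of them.
  relation : S r k n → S r k n → Region k n
  relation (x , wx) (y , wy) = (cC x y ∸ eC x y , k ∸ cC x y) ,
      subst (ℕ._≤ k) (sym (∸-telescope (eC≤cC x y) (cC≤k (x , wx) (y , wy)))) (ℕ.m∸n≤m k (eC x y))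
    , ℕ.m∸n≤m k (cC x y)
    , ℕ.m≤n+o⇒m∸n≤o k (cC x y) (ℕ.+-cancelʳ-≤ k k _ (begin
        k ℕ.+ k                        ≡⟨ cong₂ ℕ._+_ wx wy ⟨
        weight x ℕ.+ weight y          ≤⟨ count-∧ (λ i → nonzero (x i)) (λ i → nonzero (y i)) ⟩
        n ℕ.+ cC x y                   ≡⟨ ℕ.+-comm n (cC x y) ⟩
        cC x y ℕ.+ n                   ≡⟨ cong (λ w → cC x y ℕ.+ w) (ℕ.m∸n+n≡m k≤n) ⟨
        cC x y ℕ.+ (n ∸ k ℕ.+ k)       ≡⟨ ℕ.+-assoc (cC x y) (n ∸ k) k ⟨
        cC x y ℕ.+ (n ∸ k) ℕ.+ k       ∎))
    where open ℕ.≤-Reasoning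

  -- For a + b ≤ k the truncated differences in `A` are exact, so e and c determine a and b.
  A-off : ∀ u v a b → a ℕ.+ b ℕ.≤ k → (a , b) ≢ proj₁ (relation u v) → A r k n a b u v ≡ 0ℚ
  A-off (x , wx) (y , wy) a b a+b≤k ≢ with eC x y ℕ.≟ k ∸ a ∸ b | cC x y ℕ.≟ k ∸ b
  ... | no  _  | _      = refl
  ... | yes _  | no _   = refl
  ... | yes e≡ | yes c≡ = contradiction (cong₂ _,_
      (sym (trans (cong₂ _∸_ c≡ (trans e≡ (trans (ℕ.∸-+-assoc k a b)
        (trans (cong (k ∸_) (ℕ.+-comm a b)) (sym (ℕ.∸-+-assoc k b a))))))
        (ℕ.m∸[m∸n]≡n (ℕ.m+n≤o⇒m≤o∸n a a+b≤k))))
      (sym (trans (cong (k ∸_) c≡) (ℕ.m∸[m∸n]≡n (ℕ.≤-trans (ℕ.m≤n+m b a) a+b≤k))))) ≢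

  A-on : ∀ u v → let (a , b) = proj₁ (relation u v) in A r k n a b u v ≡ 1ℚ
  A-on u@(x , wx) v@(y , wy)
    with eC x y ℕ.≟ k ∸ (cC x y ∸ eC x y) ∸ (k ∸ cC x y) | cC x y ℕ.≟ k ∸ (k ∸ cC x y)
  ... | yes _  | yes _  = refl
  ... | _      | no c≢  = contradiction (sym (ℕ.m∸[m∸n]≡n (cC≤k u v))) c≢
  ... | no e≢  | yes _  = contradiction (sym (trans (ℕ.∸-+-assoc k (cC x y ∸ eC x y) (k ∸ cC x y))
      (trans (cong (k ∸_) (∸-telescope (eC≤cC x y) (cC≤k u v)))
        (ℕ.m∸[m∸n]≡n (ℕ.≤-trans (eC≤cC x y) (cC≤k u v)))))) e≢

  -- The relations partition S × S: exactly one adjacency matrix indexed by 𝒟 has entry 1 at (u, v).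
  sumD-collapse : ∀ (f : ℕ → ℕ → ℚ) u v →
    sumD k n (λ a b → f a b * A r k n a b u v) ≡ f (proj₁ (proj₁ (relation u v))) (proj₂ (proj₁ (relation u v)))
  sumD-collapse f u v = begin
    sumD k n (λ a b → f a b * A r k n a b u v)
      ≡⟨ sumTo-single k _ (ℕ.≤-trans (ℕ.m≤m+n a₀ b₀) (proj₁ d∈D))
           (λ a a≢a₀ → sumTo-zero k (λ b _ → off a b (a≢a₀ ∘ cong proj₁))) ⟩
    sumTo k (term a₀)
      ≡⟨ sumTo-single k (term a₀) (proj₁ (proj₂ d∈D)) (λ b b≢b₀ → off a₀ b (b≢b₀ ∘ cong proj₂)) ⟩
    term a₀ b₀
      ≡⟨ on ⟩
    f a₀ b₀ ∎
    where
    open ≡-Reasoning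
    a₀ b₀ : ℕ
    a₀ = proj₁ (proj₁ (relation u v))
    b₀ = proj₂ (proj₁ (relation u v))
    d∈D : InD k n (a₀ , b₀)
    d∈D = proj₂ (relation u v)
    term : ℕ → ℕ → ℚ
    term a b = if ⌊ InD? k n (a , b) ⌋ then f a b * A r k n a b u v else 0ℚ
    off : ∀ a b → (a , b) ≢ (a₀ , b₀) → term a b ≡ 0ℚ
    off a b ≢ with InD? k n (a , b)
    ... | no  _           = refl
    ... | yes (a+b≤k , _) = trans (cong (f a b *_) (A-off u v a b a+b≤k ≢)) (ℚ.*-zeroʳ (f a b))
    on : term a₀ b₀ ≡ f a₀ b₀
    on with InD? k n (a₀ , b₀)
    ... | no ∉D = contradiction d∈D ∉D
    ... | yes _ = trans (cong (f a₀ b₀ *_) (A-on u v)) (ℚ.*-identityʳ (f a₀ b₀))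

-- Degrees of the dual eigenvalues q_ij

module _ {X : Set} (U V : X → ℚ) where

  -- Solves for f, namely f = m / β - α / β. It turns a generator written through u or y into u or y
  -- written through the generator.
  affine-degree : ∀ {d} (f : X → ℚ) α β → β ≢ 0ℚ → (0 , 0) ≺ d →
    (∀ x → monomial d (U x) (V x) ≡ α + β * f x) → HasDegree U V d f
  affine-degree {d} f α β β≢0 0≺d eq = HasDegree-cong U V
    (λ x → *-cancelˡ β β≢0 (modulo₂ (- 1ℚ) (α - m x) (eq x) (*-÷′ 1ℚ β≢0) (ring-eq α β (1ℚ ÷' β) (m x) (f x))))
    (HasDegree-+ U V (HasDegree-monomial U V (1ℚ ÷' β) d (÷′-≢0 1≢0 β≢0)) (Lower-const U V (- ((1ℚ ÷' β) * α)) 0≺d))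
    where
    m : X → ℚ
    m x = monomial d (U x) (V x)
    ring-eq : ∀ α β r m f → β * f ≡ β * (r * m + (- (r * α))) + (- 1ℚ) * (m - (α + β * f)) + (α - m) * (β * r - 1ℚ)
    ring-eq = solve-∀ ℚ-ring

module _ (r k n : ℕ) (1≤k : 1 ℕ.≤ k) (k≤n : k ℕ.≤ n) (2k-1≤n : 2 ℕ.* k ∸ 1 ℕ.≤ n) where

  private
    X : Set
    X = Region k n

    x̂ ŷ : X → ℕ
    x̂ z = proj₁ (proj₁ z)
    ŷ z = proj₂ (proj₁ z)

    Q : ℕ → ℕ → X → ℚ
    Q i j z = q r k n i j (x̂ z) (ŷ z)

    t : ℚ
    t = ℤtoℚ (+ r ℤ.- + 1 ℤ.- + 1)

    m̂ : X → ℕ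
    m̂ z = k ∸ ŷ z ∸ x̂ z

    x≤k-y : ∀ z → x̂ z ℕ.≤ k ∸ ŷ z
    x≤k-y ((x , y) , x+y≤k , _) = ℕ.m+n≤o⇒m≤o∸n x x+y≤k

    y≤k : ∀ z → ŷ z ℕ.≤ k
    y≤k (_ , _ , y≤k , _) = y≤k

    ratio : ℕ → ℚ
    ratio i = binom (+ n) (+ i) ÷' binom (+ k) (+ i)

    binom≢0 : ∀ {a b} → b ℕ.≤ a → binom (+ a) (+ b) ≢ 0ℚ
    binom≢0 {a} {b} b≤a = subst (_≢ 0ℚ) (sym (binom≡choose a b)) (choose≢0 b≤a)

    ratio≢0 : ∀ {i} → i ℕ.≤ k → ratio i ≢ 0ℚ
    ratio≢0 i≤k = ÷′-≢0 (binom≢0 (ℕ.≤-trans i≤k k≤n)) (binom≢0 i≤k)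

    f : X → ℕ → ℚ
    f z = krawtchouk t (m̂ z) (x̂ z)

    u : X → ℚ
    u z = t * ι (m̂ z) - ι (x̂ z)

    f-rec : ∀ z → KrawtchoukRec t (u z) (ι k - ι (ŷ z)) (f z)
    f-rec z = subst (λ w → KrawtchoukRec t (u z) w (f z)) w≡ (krawtchouk-rec t (m̂ z) (x̂ z))
      where
      w≡ : ι (x̂ z) + ι (m̂ z) ≡ ι k - ι (ŷ z)
      w≡ = begin
        ι (x̂ z) + ι (m̂ z)      ≡⟨ ι-+ (x̂ z) (m̂ z) ⟨
        ι (x̂ z ℕ.+ m̂ z)        ≡⟨ cong ι (ℕ.m+[n∸m]≡n (x≤k-y z)) ⟩
        ι (k ∸ ŷ z)            ≡⟨ undo (ι (k ∸ ŷ z)) (ι (ŷ z)) ⟩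
        ι (k ∸ ŷ z) + ι (ŷ z) - ι (ŷ z)
          ≡⟨ cong (_- ι (ŷ z)) (trans (sym (ι-+ (k ∸ ŷ z) (ŷ z))) (cong ι (ℕ.m∸n+n≡m (y≤k z)))) ⟩
        ι k - ι (ŷ z)          ∎
        where
        open ≡-Reasoning
        undo : ∀ a b → a ≡ a + b - b
        undo = solve-∀ ℚ-ring

    f₁≡u : ∀ z → f z 1 ≡ u z
    f₁≡u z = modulo₁ 1ℚ (f-rec z 0) (ring-eq (f z 1) (u z) t (ι k - ι (ŷ z)))
      where
      ring-eq : ∀ f u t w → f ≡ u + 1ℚ * ((1ℚ + 0ℚ) * f - ((u - (t - 1ℚ) * 0ℚ) * 1ℚ - t * (w + 1ℚ - 0ℚ) * 0ℚ))
      ring-eq = solve-∀ ℚ-ring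

    -- On 𝒟 the differences a and b are exact, and n - i = (k - i) + (n - k) splits as (j + a) + (j
    -- + b). In particular 2j ≤ n - i, as the nonvanishing of `hahnFactor` requires.
    Q-formula : ∀ i j → InD k n (i , j) → ∀ z →
      let a = k ∸ i ∸ j ; b = n ∸ k ∸ j in
      Q i j z ≡ ratio i * f z i * (hahnFactor ((j ℕ.+ a) ℕ.+ (j ℕ.+ b)) j * hahnSum a b j (ŷ z))
    Q-formula i j (i+j≤k , _ , j≤n-k) z = cong₂ (λ v w → ratio i * v * w)
      (Krawtchouk≡krawtchouk i (x̂ z) (m̂ z) {+ k ℤ.- + ŷ z} (+ r ℤ.- + 1)
        (trans (cong (ℤ._- + x̂ z) (ℤ-monus (y≤k z))) (ℤ-monus (x≤k-y z))))
      (Hahn≡hahnSum (k ∸ i ∸ j) (n ∸ k ∸ j) j (ŷ z)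
        (trans (ℤ-monus (ℕ.≤-trans i≤k k≤n)) (cong +_ n-i≡))
        (trans (ℤ-monus i≤k) (cong +_ k-i≡)))
      where
      i≤k : i ℕ.≤ k
      i≤k = ℕ.≤-trans (ℕ.m≤m+n i j) i+j≤k
      k-i≡ : k ∸ i ≡ j ℕ.+ (k ∸ i ∸ j)
      k-i≡ = sym (ℕ.m+[n∸m]≡n (ℕ.m+n≤o⇒m≤o∸n j (subst (ℕ._≤ k) (ℕ.+-comm i j) i+j≤k)))
      n-i≡ : n ∸ i ≡ (j ℕ.+ (k ∸ i ∸ j)) ℕ.+ (j ℕ.+ (n ∸ k ∸ j))
      n-i≡ = trans (sym (∸-telescope i≤k k≤n)) (cong₂ ℕ._+_ k-i≡ (sym (ℕ.m+[n∸m]≡n j≤n-k)))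

    U V : X → ℚ
    U = Q 1 0
    V = Q 0 1

    -- The Hahn factor of degree 0 is 1 and K₁ = u, so U is `ratio 1` times u.
    u-degree : HasDegree U V (1 , 0) u
    u-degree = affine-degree U V u 0ℚ (ratio 1) (ratio≢0 1≤k) ((ℕ.z≤n , ℕ.z≤n) , ℕ.s≤s ℕ.z≤n) λ z → begin
      U z * 1ℚ * 1ℚ
        ≡⟨ cong (λ w → w * 1ℚ * 1ℚ) (Q-formula 1 0 (1≤k , ℕ.z≤n , ℕ.z≤n) z) ⟩
      ratio 1 * f z 1 * 1ℚ * 1ℚ * 1ℚ
        ≡⟨ cong (λ w → ratio 1 * w * 1ℚ * 1ℚ * 1ℚ) (f₁≡u z) ⟩
      ratio 1 * u z * 1ℚ * 1ℚ * 1ℚ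
        ≡⟨ ring-eq (ratio 1) (u z) ⟩
      0ℚ + ratio 1 * u z ∎
      where
      open ≡-Reasoning
      ring-eq : ∀ c u → c * u * 1ℚ * 1ℚ * 1ℚ ≡ 0ℚ + c * u
      ring-eq = solve-∀ ℚ-ring

    -- For k < n the pair (0, 1) lies in 𝒟, and V is a nonzero constant times the Newton expansion
    -- h₀ + h₁ y, whose leading coefficient h₁ is nonzero.
    y-degree-< : k ℕ.< n → HasDegree U V (0 , 1) (λ z → ι (ŷ z))
    y-degree-< k<n = affine-degree U V (λ z → ι (ŷ z)) (c * h₀) (c * h₁)
      (*-≢0 c≢0 (hahnCoeff-lead≢0 a b 1)) ((ℕ.z≤n , ℕ.z≤n) , ℕ.s≤s ℕ.z≤n) λ z → begin
        1ℚ * (V z * 1ℚ)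
          ≡⟨ cong (λ w → 1ℚ * (w * 1ℚ)) (Q-formula 0 1 (1≤k , 1≤k , ℕ.m<n⇒0<n∸m k<n) z) ⟩
        1ℚ * (ratio 0 * 1ℚ * (F * (h₀ * 1ℚ + h₁ * choose (ŷ z) 1)) * 1ℚ)
          ≡⟨ modulo₁ (ratio 0 * F * h₁) (choose-step (ŷ z) 0) (ring-eq (ratio 0) F h₀ h₁ (choose (ŷ z) 1) (ι (ŷ z))) ⟩
        c * h₀ + c * h₁ * ι (ŷ z) ∎
      where
      open ≡-Reasoning
      a b : ℕ
      a = k ∸ 0 ∸ 1
      b = n ∸ k ∸ 1
      F c h₀ h₁ : ℚ
      F = hahnFactor ((1 ℕ.+ a) ℕ.+ (1 ℕ.+ b)) 1
      c = ratio 0 * F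
      h₀ = hahnCoeff a b 1 0
      h₁ = hahnCoeff a b 1 1
      c≢0 : c ≢ 0ℚ
      c≢0 = *-≢0 (ratio≢0 ℕ.z≤n) (hahnFactor≢0 ((1 ℕ.+ a) ℕ.+ (1 ℕ.+ b)) 1 (ℕ.+-mono-≤ (ℕ.m≤m+n 1 a) (ℕ.m≤m+n 1 b)))
      ring-eq : ∀ r F h₀ h₁ c y → 1ℚ * (r * 1ℚ * (F * (h₀ * 1ℚ + h₁ * c)) * 1ℚ) ≡
        r * F * h₀ + r * F * h₁ * y + r * F * h₁ * ((1ℚ + 0ℚ) * c - (y - 0ℚ) * 1ℚ)
      ring-eq = solve-∀ ℚ-ring

    -- Here k = n = 1, so that y = 0 on 𝒟, and q₀₁ vanishes as well: its factor C(1,1) - C(1,0) is 0.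
    y-degree-≡ : k ≡ n → HasDegree U V (0 , 1) (λ z → ι (ŷ z))
    y-degree-≡ refl = HasDegree-cong U V (λ z → trans (cong ι (y≡0 z)) (sym (V≡0 z)))
      -- As V is zero on 𝒟, the monomial V with coefficient 1 represents the zero function y.
      (HasDegree-monomial U V 1ℚ (0 , 1) 1≢0)
      where
      y≡0 : ∀ z → ŷ z ≡ 0
      y≡0 z@(_ , _ , _ , y≤) = ℕ.n≤0⇒n≡0 (subst (ŷ z ℕ.≤_) (ℕ.n∸n≡0 k) y≤)
      k≡1 : k ≡ 1
      k≡1 = ℕ.≤-antisym (bound k 2k-1≤n) 1≤k
        where
        bound : ∀ k → 2 ℕ.* k ∸ 1 ℕ.≤ k → k ℕ.≤ 1
        bound zero    _  = ℕ.z≤n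
        bound (suc k) le = ℕ.+-cancelˡ-≤ k (suc k) 1
          (subst₂ ℕ._≤_ (cong (λ w → k ℕ.+ suc w) (ℕ.+-identityʳ k)) (ℕ.+-comm 1 k) le)
      -- Stated for variable k and y so that both equations can be matched; at k = 1 and y = 0 the
      -- Hahn factor computes to 0.
      Q₀₁≡0 : ∀ x {y} k → k ≡ 1 → y ≡ 0 → q r k k 0 1 x y ≡ 0ℚ
      Q₀₁≡0 x k refl refl = ℚ.*-zeroʳ ((binom (+ 1) (+ 0) ÷' binom (+ 1) (+ 0)) * Krawtchouk 0 (+ x) (+ 1) (+ r ℤ.- + 1))
      V≡0 : ∀ z → 1ℚ * (1ℚ * (V z * 1ℚ)) ≡ 0ℚ
      V≡0 z = cong (λ w → 1ℚ * (1ℚ * (w * 1ℚ))) (Q₀₁≡0 (x̂ z) k k≡1 (y≡0 z))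

    y-degree : HasDegree U V (0 , 1) (λ z → ι (ŷ z))
    y-degree with ℕ.m≤n⇒m<n∨m≡n k≤n
    ... | inj₁ k<n = y-degree-< k<n
    ... | inj₂ k≡n = y-degree-≡ k≡n

  q-degree : ∀ i j → InD k n (i , j) → HasDegree U V (i , j) (Q i j)
  q-degree i j ij∈D@(i+j≤k , _) = subst (λ i′ → HasDegree U V (i′ , j) (Q i j)) (ℕ.+-identityʳ i)
    (HasDegree-cong U V (Q-formula i j ij∈D)
      (HasDegree-* U V
        (HasDegree-scale U V (ratio i) (ratio≢0 (ℕ.≤-trans (ℕ.m≤m+n i j) i+j≤k))
          (krawtchouk-degree U V ŷ y-degree t (ι k) u f u-degree (λ _ → refl) f-rec i))
        (HasDegree-scale U V F (hahnFactor≢0 ((j ℕ.+ a) ℕ.+ (j ℕ.+ b)) j (ℕ.+-mono-≤ (ℕ.m≤m+n j a) (ℕ.m≤m+n j b)))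
          (newton-degree U V ŷ y-degree (hahnCoeff a b j) j (hahnCoeff-lead≢0 a b j)))))
    where
    a b : ℕ
    a = k ∸ i ∸ j
    b = n ∸ k ∸ j
    F : ℚ
    F = hahnFactor ((j ℕ.+ a) ℕ.+ (j ℕ.+ b)) j

  scaledE-polynomial : ∀ i j → InD k n (i , j) →
    Σ Poly λ v → CompatiblePoly 0ℚ ½ v i j ×
      (∀ x y → scaledE r k n i j x y ≡ evalH v (scaledE r k n 1 0) (scaledE r k n 0 1) x y)
  scaledE-polynomial i j ij∈D = v , compatible lead rest i j lead≢0 terms , λ x y → begin
    scaledE r k n i j x y                                        ≡⟨ sumD-collapse k≤n (q r k n i j) x y ⟩
    Q i j (relation k≤n x y)                                     ≡⟨ value (relation k≤n x y) ⟩
    eval v (U (relation k≤n x y)) (V (relation k≤n x y))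
      ≡⟨ cong₂ (eval v) (sumD-collapse k≤n (q r k n 1 0) x y) (sumD-collapse k≤n (q r k n 0 1) x y) ⟨
    eval v (scaledE r k n 1 0 x y) (scaledE r k n 0 1 x y)       ≡⟨ evalH≡eval v (scaledE r k n 1 0) (scaledE r k n 0 1) x y ⟨
    evalH v (scaledE r k n 1 0) (scaledE r k n 0 1) x y          ∎
    where
    open ≡-Reasoning
    open HasDegree (q-degree i j ij∈D)
    v : Poly
    v = (lead , i , j) ∷ rest

mainTheorem1 : (r k n : ℕ) → 3 ≤ r → 1 ≤ k → k ≤ n → 2 ℕ.* k ∸ 1 ≤ n →
    CompatibleSet 0ℚ ½ (InD k n) ×
    (∀ i j → InD k n (i , j) →
      Σ Poly λ v → CompatiblePoly 0ℚ ½ v i j ×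
        (∀ x y → scaledE r k n i j x y
                 ≡ evalH v (scaledE r k n 1 0) (scaledE r k n 0 1) x y))
mainTheorem1 r k n _ 1≤k k≤n 2k-1≤n =
    (λ i j a b ij∈D ab≼ij → InD-downward 2k-1≤n {a , b} {i , j} ij∈D (Preceq⇒≼ {a , b} {i , j} ab≼ij))
  , scaledE-polynomial r k n 1≤k k≤n 2k-1≤n
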